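{- Let $k\geq 1$ be an integer, $n=18k+2$, and let $H_k$ be the graph on the vertex set $\{0,1,\ldots,n-1\}$ consisting of all $n$ boundary edges of the convex polygon with vertices $0,1,\ldots,n-1$ in this cyclic order, together with the $18k-1$ chords $$\mathcal{C}(H_k)=\{\{n-3,n-1\}\}\ \cup\ \{R_i:0\leq i\leq k-1\}\ \cup\ \bigcup_{i=0}^{k-2}\mathcal{B}_i\ \cup\ \Gamma ,$$ where $R_i$, $\mathcal{B}_i$ and $\Gamma$ are the explicit chords and sets of chords given in the context. Then $H_k$ is a maximal outerplanar graph with degree sequence $$2^{(8k)}\ 3^{(2)}\ 5^{(8k)}\ 6^{(2)}\ 8^{(2k-2)}$$ (the exponent in parentheses is the multiplicity of the degree), and $$\mathrm{sp}(H_k,2)=8k+2=\frac{4n+10}{9}.$$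
   Context: For a graph $G$ and $B\subseteq V(G)$ the spread is $\mathrm{sp}(B)=\max_{u\in B}\deg_G(u)-\min_{v\in B}\deg_G(v)$, and $\mathrm{sp}(G,2)$ is the largest cardinality of a set $B\subseteq V(G)$ with $\mathrm{sp}(B)\leq 2$. A graph is maximal outerplanar if it is outerplanar and the addition of any edge destroys outerplanarity; equivalently, for order $n\geq 3$, it is a triangulation of a convex $n$-gon. The boundary edges are $\{i,i+1\}$ for $0\leq i\leq n-2$ together with $\{0,n-1\}$. Put $a_i=9i$ and $b_i=18k-1-9i$ for $0\leq i\leq k-2$, and $c=9k-9$. The rungs are $R_i=\{a_i,b_i\}$ for $0\leq i\leq k-2$ and $R_{k-1}=\{c,c+17\}$ (for $k=1$ there are no $a_i,b_i$ and the only rung is $R_0=\{0,17\}$). For $0\leq i\leq k-2$ let $\phi_i:\{0,\ldots,19\}\to\{0,\ldots,n-1\}$ be the local labelling $\phi_i(\ell)=a_i+\ell$ for $0\leq\ell\leq 9$ and $\phi_i(10+j)=b_i-9+j$ for $0\leq j\leq 9$. The set $\mathcal{B}_i$ consists of the $17$ chords $\{\phi_i(p),\phi_i(q)\}$ where $\{p,q\}$ is one of $\{0,2\},\{2,4\},\{4,6\},\{6,8\}$; $\{0,11\},\{0,13\},\{0,15\},\{0,17\}$; $\{2,11\},\{4,11\},\{6,11\},\{8,11\}$; $\{11,13\},\{13,15\},\{15,17\},\{17,19\}$; $\{8,10\}$. The set $\Gamma$ consists of the $15$ chords $\{c+x,c+y\}$ with $(x,y)$ one of $(0,13),(0,15),(1,3),(1,12),(1,13),(3,5),(3,10),(3,12),(5,7),(5,10),(7,9),(7,10),(10,12),(13,15),(15,17)$.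 -}

module Defs where

open import Data.Bool using (if_then_else_)
open import Data.Fin as Fin using (Fin; toℕ)
import Data.Fin.Properties as Fin
open import Data.Fin.Permutation using (Permutation′; _⟨$⟩ʳ_)
open import Data.Fin.Subset using (Subset; inside; outside; ∣_∣)
import Data.Fin.Subset.Properties as Subset
open import Data.List using (List; []; _∷_; _++_; map; concatMap; filter; allFin; upTo)
open import Data.List.Extrema.Nat using (max; min)
open import Data.Nat using (ℕ; zero; suc; _+_; _*_; _∸_; _<ᵇ_; _≤?_)
import Data.Nat.Properties as ℕ
open import Data.Product using (∃-syntax; _×_; _,_)
open import Data.Product.Properties using (≡-dec)
open import Data.Sum as Sum using (_⊎_; inj₁; inj₂)
import Data.Vec as Vec
open import Relation.Binary.Definitions using (Decidable; Irreflexive; Symmetric)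
open import Relation.Binary.PropositionalEquality using (_≡_; _≢_; refl; sym)
open import Relation.Nullary using (¬_; does)
open import Relation.Nullary.Decidable using (¬?; _×-dec_; _⊎-dec_)

import Data.List.Membership.DecPropositional (≡-dec ℕ._≟_ ℕ._≟_) as Pairs
open Pairs using (_∈_; _∈?_)

record Graph (n : ℕ) : Set₁ where
  field
    Adj    : Fin n → Fin n → Set
    adj?   : Decidable Adj
    symm   : Symmetric Adj
    irrefl : Irreflexive _≡_ Adj

open Graph public

-- The graph on {0,…,n-1} whose edges are the listed pairs, read as unordered.
-- Pairs (p , p), or with an entry ≥ n, would contribute nothing.
fromEdges : ∀ n → List (ℕ × ℕ) → Graph n
fromEdges n es = record
  { Adj    = λ x y → x ≢ y × ((toℕ x , toℕ y) ∈ es ⊎ (toℕ y , toℕ x) ∈ es)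
  ; adj?   = λ x y → ¬? (x Fin.≟ y) ×-dec
                     (((toℕ x , toℕ y) ∈? es) ⊎-dec ((toℕ y , toℕ x) ∈? es))
  ; symm   = λ (x≢y , e) → (λ y≡x → x≢y (sym y≡x)) , Sum.swap e
  ; irrefl = λ x≡y (x≢y , _) → x≢y x≡y
  }

addEdge : ∀ {n} → Graph n → (u v : Fin n) → u ≢ v → Graph n
addEdge G u v u≢v = record
  { Adj    = λ x y → Adj G x y ⊎ ((x ≡ u × y ≡ v) ⊎ (x ≡ v × y ≡ u))
  ; adj?   = λ x y → adj? G x y ⊎-dec
                     (((x Fin.≟ u) ×-dec (y Fin.≟ v)) ⊎-dec
                      ((x Fin.≟ v) ×-dec (y Fin.≟ u)))
  ; symm   = Sum.map (symm G) (λ where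
      (inj₁ (x≡u , y≡v)) → inj₂ (y≡v , x≡u)
      (inj₂ (x≡v , y≡u)) → inj₁ (y≡u , x≡v))
  ; irrefl = λ where
      x≡y  (inj₁ e)                    → irrefl G x≡y e
      refl (inj₂ (inj₁ (refl , refl))) → u≢v refl
      refl (inj₂ (inj₂ (refl , refl))) → u≢v refl
  }

-- A drawing with the vertices at the corners of a convex n-gon, in the cyclic
-- order given by π, and the edges as straight segments.  Two segments cross
-- exactly when their end points alternate around the polygon.  As the
-- quantifiers range over both orientations of both edges, it is enough to
-- exclude one linear order of the four positions.
NonCrossing : ∀ {n} → Graph n → Permutation′ n → Set
NonCrossing G π = ∀ u v x y → Adj G u v → Adj G x y →
  ¬ (pos u Fin.< pos x × pos x Fin.< pos v × pos v Fin.< pos y)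
  where
  pos : Fin _ → Fin _
  pos w = π ⟨$⟩ʳ w

Outerplanar : ∀ {n} → Graph n → Set
Outerplanar {n} G = ∃[ π ] NonCrossing {n} G π

MaximalOuterplanar : ∀ {n} → Graph n → Set
MaximalOuterplanar G = Outerplanar G ×
  (∀ u v (u≢v : u ≢ v) → ¬ Adj G u v → ¬ Outerplanar (addEdge G u v u≢v))

neighbours : ∀ {n} → Graph n → Fin n → Subset n
neighbours G u = Vec.tabulate (λ v → does (adj? G u v))

deg : ∀ {n} → Graph n → Fin n → ℕ
deg G u = ∣ neighbours G u ∣

-- As a multiset: only meaningful up to permutation.
degrees : ∀ {n} → Graph n → List ℕ
degrees {n} G = map (deg G) (allFin n)

-- The first argument of max and min is the value at the empty list, and also
-- takes part in the comparison.  It is harmless for nonempty B, since 0 is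
-- below every degree and the maximum is above every degree.  The empty set
-- gets spread 0.
spread : ∀ {n} → Graph n → Subset n → ℕ
spread {n} G B = maxDeg ∸ min maxDeg degs
  where
  degs : List ℕ
  degs = map (deg G) (filter (Subset._∈? B) (allFin n))

  maxDeg : ℕ
  maxDeg = max 0 degs

subsets : ∀ n → List (Subset n)
subsets zero    = Vec.[] ∷ []
subsets (suc n) = map (outside Vec.∷_) (subsets n) ++ map (inside Vec.∷_) (subsets n)

sp : ∀ {n} → Graph n → ℕ → ℕ
sp {n} G s = max 0 (map ∣_∣ (filter (λ B → spread G B ≤? s) (subsets n)))

order : ℕ → ℕ
order k = 18 * k + 2

boundary : ℕ → List (ℕ × ℕ)
boundary n = (0 , n ∸ 1) ∷ map (λ i → i , suc i) (upTo (n ∸ 1))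

-- For k ≥ 1 and the indices i ≤ k - 2 that are used, no subtraction below is
-- truncated, and upTo (k ∸ 1) enumerates 0 ≤ i ≤ k - 2.
a : ℕ → ℕ
a i = 9 * i

b : ℕ → ℕ → ℕ
b k i = 18 * k ∸ 1 ∸ 9 * i

c : ℕ → ℕ
c k = 9 * k ∸ 9

rungs : ℕ → List (ℕ × ℕ)
rungs k = (c k , c k + 17) ∷ map (λ i → a i , b k i) (upTo (k ∸ 1))

φ : ℕ → ℕ → ℕ → ℕ
φ k i ℓ = if ℓ <ᵇ 10 then a i + ℓ else b k i ∸ 9 + (ℓ ∸ 10)

blockPattern : List (ℕ × ℕ)
blockPattern =
  (0 , 2) ∷ (2 , 4) ∷ (4 , 6) ∷ (6 , 8) ∷
  (0 , 11) ∷ (0 , 13) ∷ (0 , 15) ∷ (0 , 17) ∷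
  (2 , 11) ∷ (4 , 11) ∷ (6 , 11) ∷ (8 , 11) ∷
  (11 , 13) ∷ (13 , 15) ∷ (15 , 17) ∷ (17 , 19) ∷
  (8 , 10) ∷ []

block : ℕ → ℕ → List (ℕ × ℕ)
block k i = map (λ (p , q) → φ k i p , φ k i q) blockPattern

capPattern : List (ℕ × ℕ)
capPattern =
  (0 , 13) ∷ (0 , 15) ∷ (1 , 3) ∷ (1 , 12) ∷ (1 , 13) ∷
  (3 , 5) ∷ (3 , 10) ∷ (3 , 12) ∷ (5 , 7) ∷ (5 , 10) ∷
  (7 , 9) ∷ (7 , 10) ∷ (10 , 12) ∷ (13 , 15) ∷ (15 , 17) ∷ []

Γ : ℕ → List (ℕ × ℕ)
Γ k = map (λ (x , y) → c k + x , c k + y) capPattern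

chords : ℕ → List (ℕ × ℕ)
chords k =
  (order k ∸ 3 , order k ∸ 1) ∷
  rungs k ++ concatMap (block k) (upTo (k ∸ 1)) ++ Γ k

H : ∀ k → Graph (order k)
H k = fromEdges (order k) (boundary (order k) ++ chords k)

{-# OPTIONS --safe #-}
module Submission where

-- A graph drawn without crossings on a convex n-gon has at most 2n - 3 edges, hence degree
-- sum at most 4n - 6.  The chords of H k lie in nested levels (one per block, then the cap):
-- each level has its end points in two short arcs, all further levels live between these
-- arcs, and inside a level there is only a fixed finite pattern to check.  So the identity
-- drawing has no crossing.  Each vertex has all its neighbours in a bounded window of
-- consecutive levels; the degrees counted in these windows are lower bounds with sum 4n - 6,
-- so they are the exact degrees, and no edge can be added.  A set of spread at most 2 is
-- contained in the set of all vertices with degrees in some interval [d, d + 2].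

open import Defs
import Algebra.Properties.CommutativeMonoid.Sum as FinSum
open import Data.Bool as Bool using (Bool; true; false; T; if_then_else_)
open import Data.Fin as Fin using (Fin; zero; suc; toℕ; fromℕ; fromℕ<; punchIn; punchOut)
import Data.Fin.Properties as Fin
open import Data.Fin.Permutation as Perm using (_⟨$⟩ʳ_; _⟨$⟩ˡ_)
open import Data.Fin.Subset as Subset using (Subset; inside; outside; ∣_∣)
import Data.Fin.Subset.Properties as Subset
open import Data.List using (List; []; _∷_; _++_; map; filter; length; foldr; concat; concatMap;
  replicate; upTo; applyUpTo; tabulate; allFin)
open import Data.List.Extrema.Nat using (max; min; argmin-sel; min≤xs; xs≤max; max≤v⁺; v≤max⁺)
open import Data.List.Membership.Propositional using (_∈_; find; lose)
open import Data.List.Membership.Propositional.Properties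
open import Data.List.Properties using (map-tabulate; ++-assoc; ++-identityʳ; filter-++; length-++)
open import Data.List.Relation.Binary.Permutation.Propositional
  using (_↭_; ↭-refl; ↭-sym; ↭-trans; ↭-reflexive; prep)
open import Data.List.Relation.Binary.Permutation.Propositional.Properties
  using (shift; ++⁺ˡ; filter-↭; ↭-length)
open import Data.List.Relation.Binary.Pointwise as Pointwise using (Pointwise; []; _∷_)
open import Data.List.Relation.Unary.All as All using (All; []; _∷_)
import Data.List.Relation.Unary.All.Properties as All
open import Data.List.Relation.Unary.Any using (here; there)
open import Data.Nat hiding (_/_)
open import Data.Nat.ListAction using (sum)
open import Data.Nat.ListAction.Properties using (sum-++)
open import Data.Nat.Properties
open import Data.Nat.Tactic.RingSolver using (solve-∀)
open import Data.Product using (∃-syntax; _×_; _,_; proj₁; proj₂)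
open import Data.Product.Properties using (≡-dec)
open import Data.Rational using (_/_)
import Data.Rational.Properties as ℚ
open import Data.Rational.Unnormalised using (mkℚᵘ; *≡*)
open import Data.Sum as Sum using (_⊎_; inj₁; inj₂)
import Data.Vec as Vec
import Data.Vec.Properties as Vec
open import Function using (_∘_; id; _⟨_⟩_)
open import Function.Definitions using (Injective)
open import Relation.Binary.Definitions using (Decidable; Symmetric; Irreflexive; tri<; tri≈; tri>)
open import Relation.Binary.PropositionalEquality
  using (_≡_; _≢_; refl; sym; trans; cong; cong₂; subst; subst₂; module ≡-Reasoning)
open import Relation.Nullary using (¬_; Dec; yes; no; does; contradiction)
open import Relation.Nullary.Decidable using (_×-dec_; _→-dec_; ¬?; from-yes; dec-true)
import Relation.Unary as U

open import Data.List.Membership.DecPropositional (≡-dec _≟_ _≟_) using (_∈?_)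
open FinSum +-0-commutativeMonoid
  using (sum-cong-≗; sum-replicate-zero; sum-init-last; sum-remove; ∑-distrib-+; ∑-comm; sum-permute)
  renaming (sum to ∑)

-- The edge bound for outerplanar graphs

χ : ∀ {p} {P : Set p} → Dec P → ℕ
χ P? = if does P? then 1 else 0

χ-no : ∀ {p} {P : Set p} (P? : Dec P) → ¬ P → χ P? ≡ 0
χ-no (yes p) ¬p = contradiction p ¬p
χ-no (no _)  _  = refl

χ-yes : ∀ {p} {P : Set p} (P? : Dec P) → P → χ P? ≡ 1
χ-yes (yes _) _ = refl
χ-yes (no ¬p) p = contradiction p ¬p

χ-⊎ : ∀ {p q r} {P : Set p} {Q : Set q} {R : Set r} (P? : Dec P) (Q? : Dec Q) (R? : Dec R) →
  (P → Q ⊎ R) → χ P? ≤ χ Q? + χ R?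
χ-⊎ (no _)  _  _  _ = z≤n
χ-⊎ (yes p) Q? R? f with f p
... | inj₁ q rewrite χ-yes Q? q = s≤s z≤n
... | inj₂ r rewrite χ-yes R? r = m≤n+m 1 (χ Q?)

χ-mono : ∀ {p q} {P : Set p} {Q : Set q} (P? : Dec P) (Q? : Dec Q) → (P → Q) → χ P? ≤ χ Q?
χ-mono (no _)  _  _ = z≤n
χ-mono (yes p) Q? f = ≤-reflexive (sym (χ-yes Q? (f p)))

∑-mono : ∀ {n} {f g : Fin n → ℕ} → (∀ i → f i ≤ g i) → ∑ f ≤ ∑ g
∑-mono {zero}  _   = z≤n
∑-mono {suc n} f≤g = +-mono-≤ (f≤g zero) (∑-mono (f≤g ∘ suc))

∑-mono-< : ∀ {n} {f g : Fin n → ℕ} → (∀ i → f i ≤ g i) → ∀ j → f j < g j → ∑ f < ∑ g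
∑-mono-< f≤g zero    fⱼ<gⱼ = +-mono-<-≤ fⱼ<gⱼ (∑-mono (f≤g ∘ suc))
∑-mono-< f≤g (suc j) fⱼ<gⱼ = +-mono-≤-< (f≤g zero) (∑-mono-< (f≤g ∘ suc) j fⱼ<gⱼ)

∑≤size : ∀ {n} {f : Fin n → ℕ} → (∀ i → f i ≤ 1) → ∑ f ≤ n
∑≤size {zero}  _   = z≤n
∑≤size {suc n} f≤1 = +-mono-≤ (f≤1 zero) (∑≤size (f≤1 ∘ suc))

∑χ-none : ∀ {n p} {P : Fin n → Set p} (P? : U.Decidable P) → (∀ i → ¬ P i) → ∑ (λ i → χ (P? i)) ≡ 0
∑χ-none {n} P? ¬P = trans (sum-cong-≗ (λ i → χ-no (P? i) (¬P i))) (sum-replicate-zero n)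

∑χ-unique : ∀ {n p} {P : Fin n → Set p} (P? : U.Decidable P) →
  (∀ {i j} → P i → P j → i ≡ j) → ∑ (λ i → χ (P? i)) ≤ 1
∑χ-unique {zero}  P? _ = z≤n
∑χ-unique {suc n} P? unique with P? zero
... | yes p = s≤s (≤-reflexive (∑χ-none (P? ∘ suc) (λ i q → Fin.0≢1+n (unique p q))))
... | no  _ = ∑χ-unique (P? ∘ suc) (λ p q → Fin.suc-injective (unique p q))

-- The summand at `ε zero` is split off by `sum-remove`. The other values of `ε` avoid that index
-- and are renumbered by `punchOut`, so the induction lowers both sizes.
∑-injective : ∀ {m n} (f : Fin n → ℕ) {ε : Fin m → Fin n} → Injective _≡_ _≡_ ε → ∑ (f ∘ ε) ≤ ∑ f
∑-injective {zero}          f _ = z≤n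
∑-injective {suc m} {zero}  f {ε} _ with () ← ε zero
∑-injective {suc m} {suc n} f {ε} inj = begin
  f (ε zero) + ∑ (f ∘ ε ∘ suc)
    ≡⟨ cong (f (ε zero) +_) (sum-cong-≗ (λ i → cong f (sym (Fin.punchIn-punchOut (ε₀≢ i))))) ⟩
  f (ε zero) + ∑ (f ∘ punchIn (ε zero) ∘ rest)
    ≤⟨ +-monoʳ-≤ _ (∑-injective (f ∘ punchIn (ε zero)) rest-injective) ⟩
  f (ε zero) + ∑ (f ∘ punchIn (ε zero))
    ≡⟨ sum-remove f ⟨
  ∑ f
    ∎
  where
  open ≤-Reasoning
  ε₀≢ : ∀ i → ε zero ≢ ε (suc i)
  ε₀≢ i ε₀≡εᵢ = Fin.0≢1+n (inj ε₀≡εᵢ)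
  rest : Fin m → Fin n
  rest i = punchOut (ε₀≢ i)
  rest-injective : Injective _≡_ _≡_ rest
  rest-injective {i} {j} eq = Fin.suc-injective (inj (Fin.punchOut-injective (ε₀≢ i) (ε₀≢ j) eq))

∣tabulate∣ : ∀ {n} (f : Fin n → Bool) → ∣ Vec.tabulate f ∣ ≡ ∑ (λ i → if f i then 1 else 0)
∣tabulate∣ {zero}  f = refl
∣tabulate∣ {suc n} f with f zero
... | true  = cong suc (∣tabulate∣ (f ∘ suc))
... | false = ∣tabulate∣ (f ∘ suc)

deg-∑ : ∀ {n} (G : Graph n) u → deg G u ≡ ∑ (λ v → χ (adj? G u v))
deg-∑ G u = ∣tabulate∣ (λ v → does (adj? G u v))

-- An injective homomorphism can only gain neighbours. Degrees computed in a small pattern thus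
-- bound degrees in `H` from below.
deg-embedding : ∀ {m n} (F : Graph m) (G : Graph n) {ε : Fin m → Fin n} → Injective _≡_ _≡_ ε →
  (∀ {u v} → Adj F u v → Adj G (ε u) (ε v)) → ∀ u → deg F u ≤ deg G (ε u)
deg-embedding F G {ε} inj hom u = begin
  deg F u                           ≡⟨ deg-∑ F u ⟩
  ∑ (λ v → χ (adj? F u v))          ≤⟨ ∑-mono (λ v → χ-mono (adj? F u v) (adj? G (ε u) (ε v)) hom) ⟩
  ∑ (λ v → χ (adj? G (ε u) (ε v)))  ≤⟨ ∑-injective (λ v → χ (adj? G (ε u) v)) inj ⟩
  ∑ (λ v → χ (adj? G (ε u) v))      ≡⟨ deg-∑ G (ε u) ⟨
  deg G (ε u)                       ∎
  where open ≤-Reasoning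

-- Orient every edge from left to right.  An edge p q that is neither the longest
-- one leaving p nor the longest one entering q would cross a longer edge, so each
-- edge is one of the two; edges leaving the first vertex are always the latter.
module NonCrossingRelation {m} {R : Fin (2 + m) → Fin (2 + m) → Set}
  (R? : Decidable R) (R-sym : Symmetric R) (R-irrefl : Irreflexive _≡_ R)
  (nc : ∀ u v x y → R u v → R x y → ¬ (u Fin.< x × x Fin.< v × v Fin.< y)) where

  Up : Fin (2 + m) → Fin (2 + m) → Set
  Up p q = p Fin.< q × R p q

  LongestFrom : Fin (2 + m) → Fin (2 + m) → Set
  LongestFrom p q = Up p q × 0 < toℕ p × (∀ q′ → Up p q′ → q′ Fin.≤ q)

  LongestTo : Fin (2 + m) → Fin (2 + m) → Set
  LongestTo q p = Up p q × (∀ p′ → Up p′ q → p Fin.≤ p′)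

  up? : Decidable Up
  up? p q = (p Fin.<? q) ×-dec R? p q

  longestFrom? : Decidable LongestFrom
  longestFrom? p q = up? p q ×-dec (0 <? toℕ p) ×-dec Fin.all? (λ q′ → up? p q′ →-dec (q′ Fin.≤? q))

  longestTo? : Decidable LongestTo
  longestTo? q p = up? p q ×-dec Fin.all? (λ p′ → up? p′ q →-dec (p Fin.≤? p′))

  up⇒longest : ∀ {p q} → Up p q → LongestFrom p q ⊎ LongestTo q p
  up⇒longest {p} {q} pq with Fin.all? (λ p′ → up? p′ q →-dec (p Fin.≤? p′))
  ... | yes longest = inj₂ (pq , longest)
  ... | no ¬longest with Fin.¬∀⟶∃¬ _ _ (λ p′ → up? p′ q →-dec (p Fin.≤? p′)) ¬longest
  ...   | p′ , ¬p≤p′ with up? p′ q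
  ...     | no ¬p′q = contradiction (λ p′q → contradiction p′q ¬p′q) ¬p≤p′
  -- `p′` is a neighbour of `q` to the left of `p`. So `p` is not the first vertex, and an edge from
  -- `p` past `q` would cross the edge from `p′` to `q`.
  ...     | yes p′q = inj₁ (pq , ≤-<-trans z≤n p′<p , λ q′ pq′ →
              ≮⇒≥ (λ q<q′ → nc p′ q p q′ (proj₂ p′q) (proj₂ pq′) (p′<p , proj₁ pq , q<q′)))
    where
    p′<p : p′ Fin.< p
    p′<p = ≰⇒> (λ p≤p′ → ¬p≤p′ (λ _ → p≤p′))

  ∑∑χ : {Q : Fin (2 + m) → Fin (2 + m) → Set} → Decidable Q → ℕ
  ∑∑χ Q? = ∑ (λ p → ∑ (λ q → χ (Q? p q)))

  -- Each vertex counts at most once. The first is excluded by `0 < toℕ p` and the last has nothing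
  -- to its right, which leaves `m`.
  ∑∑longestFrom : ∑∑χ longestFrom? ≤ m
  ∑∑longestFrom = begin
    row zero + ∑ (row ∘ suc)
      ≡⟨ cong (_+ ∑ (row ∘ suc)) (∑χ-none (longestFrom? zero) λ _ ()) ⟩
    ∑ (row ∘ suc)
      ≡⟨ sum-init-last (row ∘ suc) ⟩
    ∑ (row ∘ suc ∘ Fin.inject₁) + row (fromℕ (1 + m))
      ≡⟨ cong (∑ (row ∘ suc ∘ Fin.inject₁) +_) (∑χ-none (longestFrom? (fromℕ (1 + m)))
           λ q lf → <⇒≱ (proj₁ (proj₁ lf)) (Fin.≤fromℕ q)) ⟩
    ∑ (row ∘ suc ∘ Fin.inject₁) + 0
      ≡⟨ +-identityʳ _ ⟩
    ∑ (row ∘ suc ∘ Fin.inject₁)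
      ≤⟨ ∑≤size (λ i → row≤1 (suc (Fin.inject₁ i))) ⟩
    m
      ∎
    where
    open ≤-Reasoning
    row : Fin (2 + m) → ℕ
    row p = ∑ (λ q → χ (longestFrom? p q))
    row≤1 : ∀ p → row p ≤ 1
    row≤1 p = ∑χ-unique (longestFrom? p) λ (up₁ , _ , longest₁) (up₂ , _ , longest₂) →
      Fin.toℕ-injective (≤-antisym (longest₂ _ up₁) (longest₁ _ up₂))

  -- Each vertex counts at most once, and no edge enters the first.
  ∑∑longestTo : ∑∑χ longestTo? ≤ 1 + m
  ∑∑longestTo = begin
    row zero + ∑ (row ∘ suc)  ≡⟨ cong (_+ ∑ (row ∘ suc)) (∑χ-none (longestTo? zero) λ { _ ((() , _) , _) }) ⟩
    ∑ (row ∘ suc)             ≤⟨ ∑≤size (row≤1 ∘ suc) ⟩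
    1 + m                     ∎
    where
    open ≤-Reasoning
    row : Fin (2 + m) → ℕ
    row q = ∑ (λ p → χ (longestTo? q p))
    row≤1 : ∀ q → row q ≤ 1
    row≤1 q = ∑χ-unique (longestTo? q) λ (up₁ , longest₁) (up₂ , longest₂) →
      Fin.toℕ-injective (≤-antisym (longest₁ _ up₂) (longest₂ _ up₁))

  ∑∑-+ : ∀ (f g : Fin (2 + m) → Fin (2 + m) → ℕ) →
    ∑ (λ p → ∑ (λ q → f p q + g p q)) ≡ ∑ (λ p → ∑ (f p)) + ∑ (λ p → ∑ (g p))
  ∑∑-+ f g = trans (sum-cong-≗ (λ p → ∑-distrib-+ (f p) (g p))) (∑-distrib-+ (∑ ∘ f) (∑ ∘ g))

  ∑∑up : ∑∑χ up? ≤ (1 + m) + m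
  ∑∑up = begin
    ∑∑χ up?
      ≤⟨ ∑-mono (λ p → ∑-mono (λ q → χ-⊎ (up? p q) (longestFrom? p q) (longestTo? q p) up⇒longest)) ⟩
    ∑ (λ p → ∑ (λ q → χ (longestFrom? p q) + χ (longestTo? q p)))
      ≡⟨ ∑∑-+ (λ p q → χ (longestFrom? p q)) (λ p q → χ (longestTo? q p)) ⟩
    ∑∑χ longestFrom? + ∑ (λ p → ∑ (λ q → χ (longestTo? q p)))
      ≡⟨ cong (∑∑χ longestFrom? +_) (∑-comm (λ p q → χ (longestTo? q p))) ⟩
    ∑∑χ longestFrom? + ∑∑χ longestTo?
      ≤⟨ +-mono-≤ ∑∑longestFrom ∑∑longestTo ⟩
    m + (1 + m)
      ≡⟨ +-comm m (1 + m) ⟩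
    (1 + m) + m
      ∎
    where open ≤-Reasoning

  R⇒up : ∀ {p q} → R p q → Up p q ⊎ Up q p
  R⇒up {p} {q} r with Fin.<-cmp p q
  ... | tri< p<q _ _ = inj₁ (p<q , r)
  ... | tri≈ _ p≡q _ = contradiction r (R-irrefl p≡q)
  ... | tri> _ _ q<p = inj₂ (q<p , R-sym r)

  -- `R` holds each edge in both orders, so the bound 2n - 3 on edges, with n = 2 + m, becomes 4n -
  -- 6. The 6 stands on the left to avoid truncated subtraction.
  ∑∑R : ∑∑χ R? + 6 ≤ 4 * (2 + m)
  ∑∑R = begin
    ∑∑χ R? + 6
      ≤⟨ +-monoˡ-≤ 6 (∑-mono (λ p → ∑-mono (λ q → χ-⊎ (R? p q) (up? p q) (up? q p) R⇒up))) ⟩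
    ∑ (λ p → ∑ (λ q → χ (up? p q) + χ (up? q p))) + 6
      ≡⟨ cong (_+ 6) (∑∑-+ (λ p q → χ (up? p q)) (λ p q → χ (up? q p))) ⟩
    ∑∑χ up? + ∑ (λ p → ∑ (λ q → χ (up? q p))) + 6
      ≡⟨ cong (λ t → ∑∑χ up? + t + 6) (∑-comm (λ p q → χ (up? q p))) ⟩
    ∑∑χ up? + ∑∑χ up? + 6
      ≤⟨ +-monoˡ-≤ 6 (+-mono-≤ ∑∑up ∑∑up) ⟩
    ((1 + m) + m) + ((1 + m) + m) + 6
      ≡⟨ arith m ⟩
    4 * (2 + m)
      ∎
    where
    open ≤-Reasoning
    arith : ∀ m → ((1 + m) + m) + ((1 + m) + m) + 6 ≡ 4 * (2 + m)
    arith = solve-∀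

-- Both sums are reindexed by position on the polygon, so that the cyclic order of the drawing
-- becomes the order of `Fin`.
outerplanar⇒degreeSum : ∀ {n} {G : Graph n} → 2 ≤ n → Outerplanar G → ∑ (deg G) + 6 ≤ 4 * n
outerplanar⇒degreeSum {suc (suc m)} {G} (s≤s (s≤s z≤n)) (π , nc) = begin
  ∑ (deg G) + 6
    ≡⟨ cong (_+ 6) (sum-cong-≗ (deg-∑ G)) ⟩
  ∑ (λ u → ∑ (λ v → χ (adj? G u v))) + 6
    ≡⟨ cong (_+ 6) (sum-permute (λ u → ∑ (λ v → χ (adj? G u v))) (Perm.flip π)) ⟩
  ∑ (λ p → ∑ (λ v → χ (adj? G (vertex p) v))) + 6
    ≡⟨ cong (_+ 6) (sum-cong-≗ (λ p → sum-permute (λ v → χ (adj? G (vertex p) v)) (Perm.flip π))) ⟩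
  ∑ (λ p → ∑ (λ q → χ (adj? G (vertex p) (vertex q)))) + 6
    ≤⟨ ∑∑R ⟩
  4 * (2 + m)
    ∎
  where
  open ≤-Reasoning
  vertex : Fin (2 + m) → Fin (2 + m)
  vertex p = π ⟨$⟩ˡ p
  at : ∀ {p q} → p Fin.< q → (π ⟨$⟩ʳ vertex p) Fin.< (π ⟨$⟩ʳ vertex q)
  at = subst₂ Fin._<_ (sym (Perm.inverseʳ π)) (sym (Perm.inverseʳ π))
  open NonCrossingRelation {m} {λ p q → Adj G (vertex p) (vertex q)}
    (λ p q → adj? G (vertex p) (vertex q)) (symm G) (λ p≡q → irrefl G (cong vertex p≡q))
    (λ u v x y uv xy (u<x , x<v , v<y) → nc _ _ _ _ uv xy (at u<x , at x<v , at v<y))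

-- No entry of the adjacency matrix drops, and the one at `(u , v)` rises from 0 to 1.
addEdge-degreeSum : ∀ {n} {G : Graph n} u v (u≢v : u ≢ v) → ¬ Adj G u v →
  ∑ (deg G) < ∑ (deg (addEdge G u v u≢v))
addEdge-degreeSum {n} {G} u v u≢v ¬uv = ∑-mono-< deg≤ u deg<
  where
  G′ : Graph n
  G′ = addEdge G u v u≢v
  χ≤ : ∀ x y → χ (adj? G x y) ≤ χ (adj? G′ x y)
  χ≤ x y = χ-mono (adj? G x y) (adj? G′ x y) inj₁
  deg≤ : ∀ x → deg G x ≤ deg G′ x
  deg≤ x = subst₂ _≤_ (sym (deg-∑ G x)) (sym (deg-∑ G′ x)) (∑-mono (χ≤ x))
  deg< : deg G u < deg G′ u
  deg< = subst₂ _<_ (sym (deg-∑ G u)) (sym (deg-∑ G′ u)) (∑-mono-< (χ≤ u) v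
    (subst₂ _<_ (sym (χ-no (adj? G u v) ¬uv)) (sym (χ-yes (adj? G′ u v) (inj₂ (inj₁ (refl , refl))))) (s≤s z≤n)))

-- The degree sum is already the largest that an outerplanar graph can have, and any new edge would
-- raise it.
maximalOuterplanar : ∀ {n} {G : Graph n} → 2 ≤ n → Outerplanar G → 4 * n ≤ ∑ (deg G) + 6 → MaximalOuterplanar G
maximalOuterplanar {G = G} 2≤n op bound = op , λ u v u≢v ¬uv op′ →
  <⇒≱ (≤-<-trans bound (+-monoˡ-< 6 (addEdge-degreeSum {G = G} u v u≢v ¬uv)))
    (outerplanar⇒degreeSum {G = addEdge G u v u≢v} 2≤n op′)

-- The edges of H, and their nesting

edges : ℕ → List (ℕ × ℕ)
edges k = boundary (order k) ++ chords k

-- The outer rung, with local labels 0 and 19, is counted in the level that it encloses.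
stripPattern : List (ℕ × ℕ)
stripPattern = (0 , 19) ∷ blockPattern

rungedCap : List (ℕ × ℕ)
rungedCap = (0 , 17) ∷ capPattern

-- The local labelling relative to a i, in the block with r more blocks between it and the cap.
ψ : ℕ → ℕ → ℕ
ψ r ℓ = if ℓ <ᵇ 10 then ℓ else 16 + 18 * r + ℓ

-- The edges of `H (suc m)` without truncated subtraction. Here n = `20 + 18 * m`, and
-- `suc i + r ≡ m` says that block `i` has `r` blocks between it and the cap.
data Edge (m : ℕ) : ℕ → ℕ → Set where
  closing : Edge m 0 (19 + 18 * m)
  path    : ∀ {i} → i < 19 + 18 * m → Edge m i (suc i)
  ear     : Edge m (17 + 18 * m) (19 + 18 * m)
  strip   : ∀ i r {p q} → suc i + r ≡ m → (p , q) ∈ stripPattern → Edge m (9 * i + ψ r p) (9 * i + ψ r q)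
  cap     : ∀ {p q} → (p , q) ∈ rungedCap → Edge m (9 * m + p) (9 * m + q)

order-suc : ∀ m → order (suc m) ≡ 20 + 18 * m
order-suc m = lemma m
  where
  lemma : ∀ m → 18 * suc m + 2 ≡ 20 + 18 * m
  lemma = solve-∀

c-suc : ∀ m → c (suc m) ≡ 9 * m
c-suc m = trans (cong (_∸ 9) (*-suc 9 m)) (m+n∸m≡n 9 (9 * m))

-- The 9 stands in front so that the `∸ 9` in `φ` cancels by computation.
b-suc : ∀ i r → b (suc (suc i + r)) i ≡ 9 + (26 + 18 * r + 9 * i)
b-suc i r = trans (cong (λ t → t ∸ 1 ∸ 9 * i) (lemma i r)) (m+n∸n≡m (35 + 18 * r + 9 * i) (9 * i))
  where
  lemma : ∀ i r → 18 * suc (suc i + r) ≡ 36 + 18 * r + 9 * i + 9 * i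
  lemma = solve-∀

φ-ψ : ∀ i r ℓ → φ (suc (suc i + r)) i ℓ ≡ 9 * i + ψ r ℓ
φ-ψ i r ℓ with ℓ <ᵇ 10 in eq
... | true  = refl
... | false = begin
  b (suc (suc i + r)) i ∸ 9 + (ℓ ∸ 10)     ≡⟨ cong (λ t → t ∸ 9 + (ℓ ∸ 10)) (b-suc i r) ⟩
  26 + 18 * r + 9 * i + (ℓ ∸ 10)           ≡⟨ lemma r i (ℓ ∸ 10) ⟩
  9 * i + (16 + 18 * r + (10 + (ℓ ∸ 10)))  ≡⟨ cong (λ t → 9 * i + (16 + 18 * r + t)) (m+[n∸m]≡n 10≤ℓ) ⟩
  9 * i + (16 + 18 * r + ℓ)                ∎
  where
  open ≡-Reasoning
  10≤ℓ : 10 ≤ ℓ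
  10≤ℓ = ≮⇒≥ (λ ℓ<10 → subst (λ b → T b) eq (<⇒<ᵇ ℓ<10))
  lemma : ∀ r i x → 26 + 18 * r + 9 * i + x ≡ 9 * i + (16 + 18 * r + (10 + x))
  lemma = solve-∀

rung-suc : ∀ i r → (a i , b (suc (suc i + r)) i) ≡ (9 * i + ψ r 0 , 9 * i + ψ r 19)
rung-suc i r = cong₂ _,_ (sym (+-identityʳ _)) (trans (b-suc i r) (lemma i r))
  where
  lemma : ∀ i r → 9 + (26 + 18 * r + 9 * i) ≡ 9 * i + (16 + 18 * r + 19)
  lemma = solve-∀

order∸ : ∀ m j → order (suc m) ∸ j ≡ 20 + 18 * m ∸ j
order∸ m j = cong (_∸ j) (order-suc m)

edge⁻ : ∀ m {x y} → (x , y) ∈ edges (suc m) → Edge m x y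
edge⁻ m xy∈ with ∈-++⁻ (boundary (order (suc m))) xy∈
... | inj₁ (here refl) = subst (Edge m 0) (sym (order∸ m 1)) closing
... | inj₁ (there xy∈path) with i , i∈ , refl ← ∈-map⁻ _ xy∈path =
      path (subst (i <_) (order∸ m 1) (∈-upTo⁻ i∈))
... | inj₂ (here refl) = subst₂ (Edge m) (sym (order∸ m 3)) (sym (order∸ m 1)) ear
... | inj₂ (there (here refl)) = subst₂ (Edge m) (trans (+-identityʳ _) (sym (c-suc m))) (cong (_+ 17) (sym (c-suc m))) (cap (here refl))
... | inj₂ (there (there xy∈rest)) with ∈-++⁻ (map (λ i → a i , b (suc m) i) (upTo m)) xy∈rest
...   | inj₁ xy∈rungs with i , i∈ , refl ← ∈-map⁻ _ xy∈rungs
        -- The difference that witnesses `i < m` is the number `r` of blocks inside block `i`.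
        with r , refl ← m≤n⇒∃[o]m+o≡n (∈-upTo⁻ i∈) =
        subst (λ (x , y) → Edge m x y) (sym (rung-suc i r)) (strip i r refl (here refl))
...   | inj₂ xy∈rest′ with ∈-++⁻ (concatMap (block (suc m)) (upTo m)) xy∈rest′
...     | inj₁ xy∈blocks
          with i , i∈ , xy∈block ← find (∈-concatMap⁻ (block (suc m)) {xs = upTo m} xy∈blocks)
          with (p , q) , pq∈ , refl ← ∈-map⁻ (λ (p , q) → φ (suc m) i p , φ (suc m) i q) {xs = blockPattern} xy∈block
          with r , refl ← m≤n⇒∃[o]m+o≡n (∈-upTo⁻ i∈) =
          subst₂ (Edge m) (sym (φ-ψ i r p)) (sym (φ-ψ i r q)) (strip i r refl (there pq∈))
...     | inj₂ xy∈Γ with (p , q) , pq∈ , refl ← ∈-map⁻ (λ (x , y) → c (suc m) + x , c (suc m) + y) {xs = capPattern} xy∈Γ =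
          subst₂ (Edge m) (cong (_+ p) (sym (c-suc m))) (cong (_+ q) (sym (c-suc m))) (cap (there pq∈))

edge⁺ : ∀ m {x y} → Edge m x y → (x , y) ∈ edges (suc m)
edge⁺ m closing = ∈-++⁺ˡ {xs = boundary (order (suc m))} (here (cong (0 ,_) (sym (order∸ m 1))))
edge⁺ m (path {i} i<) = ∈-++⁺ˡ (there (∈-map⁺ (λ i → i , suc i) (∈-upTo⁺ (subst (i <_) (sym (order∸ m 1)) i<))))
edge⁺ m ear = ∈-++⁺ʳ (boundary (order (suc m))) (here (cong₂ _,_ (sym (order∸ m 3)) (sym (order∸ m 1))))
edge⁺ _ (strip i r refl (here refl)) =
  ∈-++⁺ʳ (boundary (order (suc (suc i + r)))) (there (there (∈-++⁺ˡ
    (subst (_∈ map (λ j → a j , b (suc (suc i + r)) j) (upTo (suc i + r))) (rung-suc i r)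
      (∈-map⁺ (λ j → a j , b (suc (suc i + r)) j) (∈-upTo⁺ (m≤m+n (suc i) r)))))))
edge⁺ _ (strip i r {p} {q} refl (there pq∈)) =
  ∈-++⁺ʳ (boundary (order (suc (suc i + r)))) (there (there (∈-++⁺ʳ (map (λ j → a j , b (suc (suc i + r)) j) (upTo (suc i + r)))
    (∈-++⁺ˡ (∈-concatMap⁺ (block (suc (suc i + r))) {xs = upTo (suc i + r)} (lose (∈-upTo⁺ (m≤m+n (suc i) r))
      (subst (_∈ block (suc (suc i + r)) i) (cong₂ _,_ (φ-ψ i r p) (φ-ψ i r q))
        (∈-map⁺ (λ (p , q) → φ (suc (suc i + r)) i p , φ (suc (suc i + r)) i q) pq∈))))))))
edge⁺ m (cap (here refl)) = ∈-++⁺ʳ (boundary (order (suc m)))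
  (there (here (cong₂ _,_ (trans (+-identityʳ _) (sym (c-suc m))) (cong (_+ 17) (sym (c-suc m))))))
edge⁺ m (cap {p} {q} (there pq∈)) = ∈-++⁺ʳ (boundary (order (suc m))) (there (there
  (∈-++⁺ʳ (map (λ i → a i , b (suc m) i) (upTo m)) (∈-++⁺ʳ (concatMap (block (suc m)) (upTo m))
    (subst (_∈ Γ (suc m)) (cong₂ _,_ (cong (_+ p) (c-suc m)) (cong (_+ q) (c-suc m)))
      (∈-map⁺ (λ (x , y) → c (suc m) + x , c (suc m) + y) pq∈))))))

-- Absence of crossings

Crossing : ℕ × ℕ → ℕ × ℕ → Set
Crossing (u , v) (x , y) = u < x × x < v × v < y

strip-ascending : ∀ {p q} → (p , q) ∈ stripPattern → p < q × q ≤ 19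
strip-ascending = All.lookup (from-yes (All.all? (λ (p , q) → (p <? q) ×-dec (q ≤? 19)) stripPattern))

cap-ascending : ∀ {p q} → (p , q) ∈ rungedCap → p < q × q ≤ 17
cap-ascending = All.lookup (from-yes (All.all? (λ (p , q) → (p <? q) ×-dec (q ≤? 17)) rungedCap))

NoneCrossing : List (ℕ × ℕ) → Set
NoneCrossing es = ∀ {e f} → e ∈ es → f ∈ es → ¬ Crossing e f

noneCrossing? : ∀ es → Dec (All (λ e → All (λ f → ¬ Crossing e f) es) es)
noneCrossing? es = All.all? (λ (u , v) → All.all? (λ (x , y) → ¬? ((u <? x) ×-dec (x <? v) ×-dec (v <? y))) es) es

strip-noneCrossing : NoneCrossing stripPattern
strip-noneCrossing e∈ f∈ = All.lookup (All.lookup (from-yes (noneCrossing? stripPattern)) e∈) f∈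

cap-noneCrossing : NoneCrossing rungedCap
cap-noneCrossing e∈ f∈ = All.lookup (All.lookup (from-yes (noneCrossing? rungedCap)) e∈) f∈

ψ-mono-≤ : ∀ r {p q} → p ≤ q → ψ r p ≤ ψ r q
ψ-mono-≤ r {p} {q} p≤q with p <ᵇ 10 in p? | q <ᵇ 10 in q?
... | true  | true  = p≤q
... | true  | false = ≤-trans p≤q (m≤n+m q (16 + 18 * r))
... | false | false = +-monoʳ-≤ (16 + 18 * r) p≤q
... | false | true  = contradiction (≤-<-trans p≤q (<ᵇ⇒< q 10 (subst T (sym q?) _))) (λ p<10 → subst T p? (<⇒<ᵇ p<10))

ψ-mono-< : ∀ r {p q} → p < q → ψ r p < ψ r q
ψ-mono-< r {p} {q} p<q = ≤-trans (suc-ψ p) (ψ-mono-≤ r p<q)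
  where
  suc-ψ : ∀ p → ψ r p < ψ r (suc p)
  suc-ψ p with p <ᵇ 10 in p? | suc p <ᵇ 10 in q?
  ... | true  | true  = ≤-refl
  ... | true  | false = m≤n+m (suc p) (16 + 18 * r)
  ... | false | false = +-monoʳ-< (16 + 18 * r) ≤-refl
  ... | false | true  = contradiction (<-trans (n<1+n p) (<ᵇ⇒< (suc p) 10 (subst T (sym q?) _))) (λ p<10 → subst T p? (<⇒<ᵇ p<10))

-- Pulls a crossing inside one block back to its labels, where only a finite check remains.
ψ-cancel-< : ∀ r {p q} → ψ r p < ψ r q → p < q
ψ-cancel-< r ψp<ψq = ≰⇒> (λ q≤p → <⇒≱ ψp<ψq (ψ-mono-≤ r q≤p))

-- These are the two arcs of a block; all later levels lie in the gap between them.
ψ-outside : ∀ r p → ψ r p ≤ 9 ⊎ 26 + 18 * r ≤ ψ r p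
ψ-outside r p with p <ᵇ 10 in p?
... | true  = inj₁ (s≤s⁻¹ (<ᵇ⇒< p 10 (subst T (sym p?) _)))
... | false = inj₂ (≤-trans (≤-reflexive (+-comm 10 (16 + 18 * r)))
        (+-monoʳ-≤ (16 + 18 * r) (≮⇒≥ (λ p<10 → subst T p? (<⇒<ᵇ p<10)))))

Inside Outside : ℕ → ℕ → ℕ × ℕ → Set
Inside  lo hi (x , y) = lo ≤ x × y ≤ hi
Outside lo hi (x , y) = (x ≤ lo ⊎ hi ≤ x) × (y ≤ lo ⊎ hi ≤ y)

-- `x` would lie strictly between the ends of `e`, hence strictly between `lo` and `hi`.
inside⇒¬crossing-outside : ∀ {lo hi e f} → Inside lo hi e → Outside lo hi f → ¬ Crossing e f
inside⇒¬crossing-outside (lo≤u , _)    (inj₁ x≤lo , _) (u<x , _)     = <⇒≱ u<x (≤-trans x≤lo lo≤u)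
inside⇒¬crossing-outside (_    , v≤hi) (inj₂ hi≤x , _) (_ , x<v , _) = <⇒≱ x<v (≤-trans v≤hi hi≤x)

-- `v` would lie strictly between the ends of `f`, hence strictly between `lo` and `hi`.
outside⇒¬crossing-inside : ∀ {lo hi e f} → Outside lo hi e → Inside lo hi f → ¬ Crossing e f
outside⇒¬crossing-inside (_ , inj₁ v≤lo) (lo≤x , _)    (_ , x<v , _) = <⇒≱ x<v (≤-trans v≤lo lo≤x)
outside⇒¬crossing-inside (_ , inj₂ hi≤v) (_    , y≤hi) (_ , _ , v<y) = <⇒≱ v<y (≤-trans y≤hi hi≤v)

strip-outside : ∀ i r p q → Outside (9 * i + 9) (9 * i + (26 + 18 * r)) (9 * i + ψ r p , 9 * i + ψ r q)
strip-outside i r p q = side p , side q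
  where
  side : ∀ ℓ → 9 * i + ψ r ℓ ≤ 9 * i + 9 ⊎ 9 * i + (26 + 18 * r) ≤ 9 * i + ψ r ℓ
  side ℓ = Sum.map (+-monoʳ-≤ (9 * i)) (+-monoʳ-≤ (9 * i)) (ψ-outside r ℓ)

strip-inside : ∀ i r {p q} → (p , q) ∈ stripPattern →
  Inside (9 * i) (9 * i + (35 + 18 * r)) (9 * i + ψ r p , 9 * i + ψ r q)
strip-inside i r {p} {q} pq∈ = m≤m+n (9 * i) _ , +-monoʳ-≤ (9 * i)
  (≤-trans (ψ-mono-≤ r (proj₂ (strip-ascending pq∈))) (≤-reflexive (+-comm (16 + 18 * r) 19)))

cap-inside : ∀ m {p q} → (p , q) ∈ rungedCap → Inside (9 * m) (9 * m + 17) (9 * m + p , 9 * m + q)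
cap-inside m pq∈ = m≤m+n (9 * m) _ , +-monoʳ-≤ (9 * m) (proj₂ (cap-ascending pq∈))

inside-weaken : ∀ {lo lo′ hi hi′ e} → lo′ ≤ lo → hi ≤ hi′ → Inside lo hi e → Inside lo′ hi′ e
inside-weaken lo′≤lo hi≤hi′ (lo≤x , y≤hi) = ≤-trans lo′≤lo lo≤x , ≤-trans y≤hi hi≤hi′

-- With `i′ = suc i + d` the equation forces `r = suc (d + r′)`, and both bounds hold with slack
-- `9 * d`.
nested-strip : ∀ {i r i′ r′ e} → suc i + r ≡ suc i′ + r′ → i < i′ →
  Inside (9 * i′) (9 * i′ + (35 + 18 * r′)) e → Inside (9 * i + 9) (9 * i + (26 + 18 * r)) e
nested-strip {i} {r} {i′} {r′} {e} eq i<i′ = go (m≤n⇒∃[o]m+o≡n i<i′)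
  where
  reassoc : ∀ i d r′ → suc (suc i + d) + r′ ≡ suc i + suc (d + r′)
  reassoc = solve-∀
  lower : ∀ i d → 9 * i + 9 + 9 * d ≡ 9 * (suc i + d)
  lower = solve-∀
  upper : ∀ i d r′ → 9 * (suc i + d) + (35 + 18 * r′) + 9 * d ≡ 9 * i + (26 + 18 * suc (d + r′))
  upper = solve-∀
  go : ∃[ d ] suc i + d ≡ i′ → Inside (9 * i′) (9 * i′ + (35 + 18 * r′)) e → Inside (9 * i + 9) (9 * i + (26 + 18 * r)) e
  go (d , refl) with refl ← +-cancelˡ-≡ (suc i) r (suc (d + r′)) (trans eq (reassoc i d r′)) =
    inside-weaken (≤-trans (m≤m+n _ (9 * d)) (≤-reflexive (lower i d))) (≤-trans (m≤m+n _ (9 * d)) (≤-reflexive (upper i d r′)))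

nested-cap : ∀ i r {m e} → suc i + r ≡ m →
  Inside (9 * m) (9 * m + 17) e → Inside (9 * i + 9) (9 * i + (26 + 18 * r)) e
nested-cap i r refl =
  inside-weaken (≤-trans (m≤m+n _ (9 * r)) (≤-reflexive (lower i r))) (≤-trans (m≤m+n _ (9 * r)) (≤-reflexive (upper i r)))
  where
  lower : ∀ i r → 9 * i + 9 + 9 * r ≡ 9 * (suc i + r)
  lower = solve-∀
  upper : ∀ i r → 9 * (suc i + r) + 17 + 9 * r ≡ 9 * i + (26 + 18 * r)
  upper = solve-∀

strip-below-ear : ∀ i r {m e} → suc i + r ≡ m → Inside (9 * i) (9 * i + (35 + 18 * r)) e → Inside 0 (17 + 18 * m) e
strip-below-ear i r refl = inside-weaken z≤n (≤-trans (m≤m+n _ (9 * i)) (≤-reflexive (upper i r)))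
  where
  upper : ∀ i r → 9 * i + (35 + 18 * r) + 9 * i ≡ 17 + 18 * (suc i + r)
  upper = solve-∀

cap-below-ear : ∀ m {e} → Inside (9 * m) (9 * m + 17) e → Inside 0 (17 + 18 * m) e
cap-below-ear m = inside-weaken z≤n (≤-trans (m≤m+n _ (9 * m)) (≤-reflexive (upper m)))
  where
  upper : ∀ m → 9 * m + 17 + 9 * m ≡ 17 + 18 * m
  upper = solve-∀

ear-outside : ∀ m → Outside 0 (17 + 18 * m) (17 + 18 * m , 19 + 18 * m)
ear-outside m = inj₂ ≤-refl , inj₂ (m≤n+m _ 2)

edge-< : ∀ {m x y} → Edge m x y → x < y
edge-< closing           = s≤s z≤n
edge-< (path _)          = ≤-refl
edge-< ear               = n<1+n _ ⟨ <-trans ⟩ n<1+n _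
edge-< (strip i r _ pq∈) = +-monoʳ-< (9 * i) (ψ-mono-< r (proj₁ (strip-ascending pq∈)))
edge-< {m} (cap pq∈)     = +-monoʳ-< (9 * m) (proj₁ (cap-ascending pq∈))

crossing-+ˡ : ∀ n {u v x y} → Crossing (n + u , n + v) (n + x , n + y) → Crossing (u , v) (x , y)
crossing-+ˡ n (u<x , x<v , v<y) = +-cancelˡ-< n _ _ u<x , +-cancelˡ-< n _ _ x<v , +-cancelˡ-< n _ _ v<y

-- A boundary edge in either place, or the ear in first place, contradicts the order at once. The
-- ear in second place lies outside all levels. Different levels are separated by nesting, and one
-- level reduces to the check on labels.
edge-¬crossing : ∀ {m u v x y} → Edge m u v → Edge m x y → y < 20 + 18 * m → ¬ Crossing (u , v) (x , y)
edge-¬crossing closing _ y<n (_ , _ , v<y) = <⇒≱ v<y (s≤s⁻¹ y<n)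
edge-¬crossing ear     _ y<n (_ , _ , v<y) = <⇒≱ v<y (s≤s⁻¹ y<n)
edge-¬crossing (path _) _ _ (u<x , x<v , _) = <⇒≱ x<v u<x
edge-¬crossing _ closing _ (() , _)
edge-¬crossing _ (path _) _ (_ , x<v , v<y) = <⇒≱ v<y x<v
edge-¬crossing {m} (strip i r eq pq∈) ear _ = inside⇒¬crossing-outside (strip-below-ear i r eq (strip-inside i r pq∈)) (ear-outside m)
edge-¬crossing {m} (cap pq∈) ear _ = inside⇒¬crossing-outside (cap-below-ear m (cap-inside m pq∈)) (ear-outside m)
edge-¬crossing {m} (cap pq∈) (cap pq∈′) _ = cap-noneCrossing pq∈ pq∈′ ∘ crossing-+ˡ (9 * m)
edge-¬crossing {m} (strip i r {p} {q} eq _) (cap pq∈′) _ =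
  outside⇒¬crossing-inside (strip-outside i r p q) (nested-cap i r eq (cap-inside m pq∈′))
edge-¬crossing {m} (cap pq∈) (strip i r {p} {q} eq _) _ =
  inside⇒¬crossing-outside (nested-cap i r eq (cap-inside m pq∈)) (strip-outside i r p q)
edge-¬crossing (strip i r {p} {q} eq pq∈) (strip i′ r′ {p′} {q′} eq′ pq∈′) _ with <-cmp i i′
... | tri< i<i′ _ _ = outside⇒¬crossing-inside (strip-outside i r p q)
        (nested-strip (trans eq (sym eq′)) i<i′ (strip-inside i′ r′ pq∈′))
... | tri> _ _ i′<i = inside⇒¬crossing-outside (nested-strip (trans eq′ (sym eq)) i′<i (strip-inside i r pq∈))
        (strip-outside i′ r′ p′ q′)
... | tri≈ _ refl _ with refl ← +-cancelˡ-≡ (suc i) r r′ (trans eq (sym eq′)) = λ crossing →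
        let u<x , x<v , v<y = crossing-+ˡ (9 * i) crossing in
        strip-noneCrossing pq∈ pq∈′ (ψ-cancel-< r u<x , ψ-cancel-< r x<v , ψ-cancel-< r v<y)

adj⇒edge : ∀ {m u v} → Adj (H (suc m)) u v → u Fin.< v → Edge m (toℕ u) (toℕ v)
adj⇒edge {m} (_ , inj₁ uv∈) _   = edge⁻ m uv∈
adj⇒edge {m} (_ , inj₂ vu∈) u<v = contradiction u<v (<-asym (edge-< (edge⁻ m vu∈)))

H-outerplanar : ∀ m → Outerplanar (H (suc m))
H-outerplanar m = Perm.id , λ u v x y uv xy (u<x , x<v , v<y) →
  edge-¬crossing (adj⇒edge uv (<-trans u<x x<v)) (adj⇒edge xy (<-trans x<v v<y))
    (subst (toℕ y <_) (order-suc m) (Fin.toℕ<n y)) (u<x , x<v , v<y)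

-- The degrees of H

-- Junk value 0 for x ≥ n.
degAt : ∀ {n} → Graph n → ℕ → ℕ
degAt {n} G x with x <? n
... | yes x<n = deg G (fromℕ< x<n)
... | no  _   = 0

degAt-toℕ : ∀ {n} (G : Graph n) u → degAt G (toℕ u) ≡ deg G u
degAt-toℕ {n} G u with toℕ u <? n
... | yes u<n = cong (deg G) (Fin.fromℕ<-toℕ u u<n)
... | no  u≮n = contradiction (Fin.toℕ<n u) u≮n

tabulate-applyUpTo : ∀ {n} {f : Fin n → ℕ} {g : ℕ → ℕ} → (∀ i → g (toℕ i) ≡ f i) → tabulate f ≡ applyUpTo g n
tabulate-applyUpTo {zero}  _   = refl
tabulate-applyUpTo {suc n} g≗f = cong₂ _∷_ (sym (g≗f zero)) (tabulate-applyUpTo (g≗f ∘ suc))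

degrees-applyUpTo : ∀ {n} (G : Graph n) → degrees G ≡ applyUpTo (degAt G) n
degrees-applyUpTo G = trans (map-tabulate id (deg G)) (tabulate-applyUpTo (degAt-toℕ G))

sum-tabulate : ∀ {n} (f : Fin n → ℕ) → sum (tabulate f) ≡ ∑ f
sum-tabulate {zero}  f = refl
sum-tabulate {suc n} f = cong (f zero +_) (sum-tabulate (f ∘ suc))

sum-degrees : ∀ {n} (G : Graph n) → sum (degrees G) ≡ ∑ (deg G)
sum-degrees G = trans (cong sum (map-tabulate id (deg G))) (sum-tabulate (deg G))

-- Vertices are numbers here, so that the degree in a concrete pattern can be evaluated.
degAt-embedding : ∀ {m n} (es : List (ℕ × ℕ)) (G : Graph n) (ε : ℕ → ℕ) →
  (ε< : ∀ {p} → p < m → ε p < n) → (∀ {p q} → p < m → q < m → ε p ≡ ε q → p ≡ q) →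
  (∀ {p q} (p<m : p < m) (q<m : q < m) → p ≢ q → (p , q) ∈ es → Adj G (fromℕ< (ε< p<m)) (fromℕ< (ε< q<m))) →
  ∀ {p} → p < m → degAt (fromEdges m es) p ≤ degAt G (ε p)
degAt-embedding {m} {n} es G ε ε< ε-injective hom {p} p<m = begin
  degAt F p                       ≡⟨ cong (degAt F) (Fin.toℕ-fromℕ< p<m) ⟨
  degAt F (toℕ (fromℕ< p<m))      ≡⟨ degAt-toℕ F (fromℕ< p<m) ⟩
  deg F (fromℕ< p<m)              ≤⟨ deg-embedding F G ι-injective ι-hom (fromℕ< p<m) ⟩
  deg G (ι (fromℕ< p<m))          ≡⟨ degAt-toℕ G (ι (fromℕ< p<m)) ⟨
  degAt G (toℕ (ι (fromℕ< p<m)))  ≡⟨ cong (degAt G) (trans (toℕ-ι (fromℕ< p<m)) (cong ε (Fin.toℕ-fromℕ< p<m))) ⟩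
  degAt G (ε p)                   ∎
  where
  open ≤-Reasoning
  F : Graph m
  F = fromEdges m es
  ι : Fin m → Fin n
  ι u = fromℕ< (ε< (Fin.toℕ<n u))
  toℕ-ι : ∀ u → toℕ (ι u) ≡ ε (toℕ u)
  toℕ-ι u = Fin.toℕ-fromℕ< (ε< (Fin.toℕ<n u))
  ι-injective : ∀ {u v} → ι u ≡ ι v → u ≡ v
  ι-injective {u} {v} eq = Fin.toℕ-injective (ε-injective (Fin.toℕ<n u) (Fin.toℕ<n v)
    (trans (sym (toℕ-ι u)) (trans (cong toℕ eq) (toℕ-ι v))))
  ι-hom : ∀ {u v} → Adj F u v → Adj G (ι u) (ι v)
  ι-hom {u} {v} (u≢v , inj₁ uv∈) = hom (Fin.toℕ<n u) (Fin.toℕ<n v) (u≢v ∘ Fin.toℕ-injective) uv∈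
  ι-hom {u} {v} (u≢v , inj₂ vu∈) = symm G (hom (Fin.toℕ<n v) (Fin.toℕ<n u) (u≢v ∘ sym ∘ Fin.toℕ-injective) vu∈)

-- Orientation is forgotten because the cyclic predecessor of vertex 0 is the last vertex, which
-- reverses the edges to it.
Edge± : ℕ → ℕ × ℕ → Set
Edge± m (x , y) = Edge m x y ⊎ Edge m y x

edge⇒adj : ∀ m {u v : Fin (order (suc m))} → Edge± m (toℕ u , toℕ v) → Adj (H (suc m)) u v
edge⇒adj m uv = distinct uv , Sum.map (edge⁺ m) (edge⁺ m) uv
  where
  distinct : ∀ {u v : Fin (order (suc m))} → Edge± m (toℕ u , toℕ v) → u ≢ v
  distinct (inj₁ e) refl = <-irrefl refl (edge-< e)
  distinct (inj₂ e) refl = <-irrefl refl (edge-< e)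

H-embedding : ∀ m l es (ε : ℕ → ℕ) → (∀ {p} → p < l → ε p < 20 + 18 * m) →
  (∀ {p q} → p < l → q < l → ε p ≡ ε q → p ≡ q) →
  All (λ (p , q) → Edge± m (ε p , ε q)) es →
  ∀ {p} → p < l → degAt (fromEdges l es) p ≤ degAt (H (suc m)) (ε p)
H-embedding m l es ε ε< ε-injective es⁺ = degAt-embedding es (H (suc m)) ε ε<′ ε-injective λ p<l q<l _ pq∈ →
  edge⇒adj m (subst₂ (λ x y → Edge± m (x , y)) (sym (Fin.toℕ-fromℕ< (ε<′ p<l))) (sym (Fin.toℕ-fromℕ< (ε<′ q<l)))
    (All.lookup es⁺ pq∈))
  where
  ε<′ : ∀ {p} → p < l → ε p < order (suc m)
  ε<′ {p} p<l = subst (ε p <_) (sym (order-suc m)) (ε< p<l)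

extend : ℕ → (ℕ → ℕ) → ℕ → ℕ
extend x f zero    = x
extend x f (suc ℓ) = f ℓ

strictlyMonotone⇒injective : ∀ {f : ℕ → ℕ} → (∀ {p q} → p < q → f p < f q) → ∀ {p q} → f p ≡ f q → p ≡ q
strictlyMonotone⇒injective mono {p} {q} eq with <-cmp p q
... | tri< p<q _ _ = contradiction eq (<⇒≢ (mono p<q))
... | tri≈ _ p≡q _ = p≡q
... | tri> _ _ q<p = contradiction (sym eq) (<⇒≢ (mono q<p))

-- The vertex before 9 i in the cyclic order.
before : ℕ → ℕ → ℕ
before m zero    = 19 + 18 * m
before m (suc j) = 8 + 9 * j

-- The rung starting at 9 i ends at 9 i + 17 + 18 s, where s is the number of levels inside it.
module _ (i s : ℕ) where

  before-start : Edge± (i + s) (before (i + s) i , 9 * i)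
  before-start = go i
    where
    go : ∀ i → Edge± (i + s) (before (i + s) i , 9 * i)
    go zero    = inj₂ closing
    go (suc j) = inj₁ (subst (Edge (suc j + s) (8 + 9 * j)) (sym (*-suc 9 j)) (path (≤-trans (m≤m+n _ _) (≤-reflexive (lemma j s)))))
      where
      lemma : ∀ j s → suc (8 + 9 * j) + (28 + 9 * j + 18 * s) ≡ 19 + 18 * (suc j + s)
      lemma = solve-∀

  -- For the outermost level this is the ear. Otherwise it is the chord between local labels 8 and
  -- 10 of the preceding block, whose label 10 is the end of this rung.
  before-end : Edge± (i + s) (before (i + s) i , 9 * i + (17 + 18 * s))
  before-end = go i
    where
    go : ∀ i → Edge± (i + s) (before (i + s) i , 9 * i + (17 + 18 * s))
    go zero    = inj₂ ear
    go (suc j) = inj₁ (subst₂ (Edge (suc j + s)) (+-comm (9 * j) 8) (lemma j s) (strip j s refl (from-yes ((8 , 10) ∈? stripPattern))))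
      where
      lemma : ∀ j s → 9 * j + (16 + 18 * s + 10) ≡ 9 * suc j + (17 + 18 * s)
      lemma = solve-∀

  -- A window reaches at most one vertex past the end of the rung. In the outermost level this stops
  -- just short of the last vertex.
  before≢ : ∀ {x} → x ≤ 18 + 18 * s → before (i + s) i ≢ 9 * i + x
  before≢ {x} x≤ = go i
    where
    go : ∀ i → before (i + s) i ≢ 9 * i + x
    go zero    eq = <⇒≢ (s≤s x≤) (sym eq)
    go (suc j) eq = <⇒≢ (≤-trans (≤-reflexive (sym (*-suc 9 j))) (m≤m+n (9 * suc j) x)) eq

  9i+x< : ∀ {x} → x ≤ 18 + 18 * s → 9 * i + x < 20 + 18 * (i + s)
  9i+x< {x} x≤ = begin-strict
    9 * i + x                            ≤⟨ +-monoʳ-≤ (9 * i) x≤ ⟩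
    9 * i + (18 + 18 * s)                <⟨ m<m+n _ (s≤s z≤n) ⟩
    9 * i + (18 + 18 * s) + (2 + 9 * i)  ≡⟨ lemma i s ⟩
    20 + 18 * (i + s)                    ∎
    where
    open ≤-Reasoning
    lemma : ∀ i s → 9 * i + (18 + 18 * s) + (2 + 9 * i) ≡ 20 + 18 * (i + s)
    lemma = solve-∀

  before< : before (i + s) i < 20 + 18 * (i + s)
  before< = go i (9i+x< z≤n)
    where
    go : ∀ i → 9 * i + 0 < 20 + 18 * (i + s) → before (i + s) i < 20 + 18 * (i + s)
    go zero    _  = ≤-refl
    go (suc j) 9i< = <-trans (≤-reflexive (trans (sym (*-suc 9 j)) (sym (+-identityʳ _)))) 9i<

-- The vertices 9 i + g ℓ with labels ℓ + 1, preceded under label 0 by the vertex before 9 i,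
-- which is adjacent to both ends 9 i + g 0 and 9 i + g t of the rung.  The labels ℓ in rim
-- are those for which g ℓ and g (ℓ + 1) are consecutive.
window : ℕ → List ℕ → List (ℕ × ℕ) → List (ℕ × ℕ)
window t rim es = (0 , 1) ∷ (0 , suc t) ∷
  map (λ (p , q) → suc p , suc q) (map (λ ℓ → ℓ , suc ℓ) rim ++ es)

-- Serves both kinds of level: `g` is `ψ r` in a block and the identity in the cap.
window-degree : ∀ i s {m} → i + s ≡ m → ∀ l t rim es (g : ℕ → ℕ) →
  (∀ {p q} → p < q → g p < g q) → (∀ {ℓ} → ℓ < l → g ℓ ≤ 18 + 18 * s) → g 0 ≡ 0 → g t ≡ 17 + 18 * s →
  All (λ ℓ → suc ℓ < l × g (suc ℓ) ≡ suc (g ℓ)) rim →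
  (∀ {p q} → (p , q) ∈ es → Edge m (9 * i + g p) (9 * i + g q)) →
  ∀ {ℓ} → ℓ < l → degAt (fromEdges (suc l) (window t rim es)) (suc ℓ) ≤ degAt (H (suc m)) (9 * i + g ℓ)
window-degree i s refl l t rim es g g-mono g≤ g₀ gₜ rim⁺ es⁺ ℓ<l =
  H-embedding m (suc l) (window t rim es) ε ε< ε-injective
    (subst (λ y → Edge± m (x , y)) (trans (sym (+-identityʳ (9 * i))) (cong (9 * i +_) (sym g₀))) (before-start i s)
    ∷ subst (λ y → Edge± m (x , y)) (cong (9 * i +_) (sym gₜ)) (before-end i s)
    ∷ All.map⁺ (All.++⁺ (All.map⁺ (All.map path⁺ rim⁺)) (All.tabulate (λ pq∈ → inj₁ (es⁺ pq∈)))))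
    (s≤s ℓ<l)
  where
  m x : ℕ
  m = i + s
  x = before m i
  ε : ℕ → ℕ
  ε = extend x (λ ℓ → 9 * i + g ℓ)
  ε< : ∀ {p} → p < suc l → ε p < 20 + 18 * m
  ε< {zero}  _     = before< i s
  ε< {suc p} 1+p<l = 9i+x< i s (g≤ (s≤s⁻¹ 1+p<l))
  ε-injective : ∀ {p q} → p < suc l → q < suc l → ε p ≡ ε q → p ≡ q
  ε-injective {zero}  {zero}  _  _  _  = refl
  ε-injective {zero}  {suc q} _  q< eq = contradiction eq (before≢ i s (g≤ (s≤s⁻¹ q<)))
  ε-injective {suc p} {zero}  p< _  eq = contradiction (sym eq) (before≢ i s (g≤ (s≤s⁻¹ p<)))
  ε-injective {suc p} {suc q} _  _  eq = cong suc (strictlyMonotone⇒injective g-mono (+-cancelˡ-≡ (9 * i) _ _ eq))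
  path⁺ : ∀ {ℓ} → suc ℓ < l × g (suc ℓ) ≡ suc (g ℓ) → Edge± m (9 * i + g ℓ , 9 * i + g (suc ℓ))
  path⁺ {ℓ} (1+ℓ<l , gₛ) = inj₁ (subst (Edge m (9 * i + g ℓ)) (sym eq)
      (path (s≤s⁻¹ (subst (_< 20 + 18 * m) eq (9i+x< i s (g≤ 1+ℓ<l))))))
    where
    eq : 9 * i + g (suc ℓ) ≡ suc (9 * i + g ℓ)
    eq = trans (cong (9 * i +_) gₛ) (+-suc (9 * i) (g ℓ))

-- Label 9 is left out, since the inner levels separate labels 9 and 10. Label 19 leads to 20, the
-- boundary neighbour past the end of the rung.
stripRim : List ℕ
stripRim = upTo 9 ++ map (10 +_) (upTo 10)

stripDegree : ℕ → ℕ
stripDegree ℓ = degAt (fromEdges 22 (window 19 stripRim stripPattern)) (suc ℓ)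

capDegree : ℕ → ℕ
capDegree ℓ = degAt (fromEdges 20 (window 17 (upTo 18) rungedCap)) (suc ℓ)

-- Labels 0 to 3 stand for the vertices 0, n - 3, n - 2 and n - 1.
earPattern : List (ℕ × ℕ)
earPattern = (0 , 3) ∷ (1 , 3) ∷ (1 , 2) ∷ (2 , 3) ∷ []

earDegree : ℕ → ℕ
earDegree ℓ = degAt (fromEdges 4 earPattern) (2 + ℓ)

stripDegree≤ : ∀ i r {m} → suc i + r ≡ m → ∀ {ℓ} → ℓ < 21 → stripDegree ℓ ≤ degAt (H (suc m)) (9 * i + ψ r ℓ)
-- The rung encloses `r` further blocks and the cap, hence `suc r` levels.
stripDegree≤ i r eq = window-degree i (suc r) (trans (+-suc i r) eq) 21 19 stripRim stripPattern (ψ r) (ψ-mono-< r)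
  (λ ℓ<21 → ≤-trans (ψ-mono-≤ r (s≤s⁻¹ ℓ<21)) (≤-reflexive (ψ20 r))) refl (ψ19 r)
  (All.map (λ (1+ℓ< , same-side) → 1+ℓ< , ψ-suc same-side)
    (from-yes (All.all? (λ ℓ → (suc ℓ <? 21) ×-dec ((suc ℓ <ᵇ 10) Bool.≟ (ℓ <ᵇ 10))) stripRim)))
  (strip i r eq)
  where
  ψ20 : ∀ r → 16 + 18 * r + 20 ≡ 18 + 18 * suc r
  ψ20 = solve-∀
  ψ19 : ∀ r → 16 + 18 * r + 19 ≡ 17 + 18 * suc r
  ψ19 = solve-∀
  ψ-suc : ∀ {ℓ} → (suc ℓ <ᵇ 10) ≡ (ℓ <ᵇ 10) → ψ r (suc ℓ) ≡ suc (ψ r ℓ)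
  ψ-suc {ℓ} same-side rewrite same-side with ℓ <ᵇ 10
  ... | true  = refl
  ... | false = +-suc (16 + 18 * r) ℓ

capDegree≤ : ∀ m {ℓ} → ℓ < 19 → capDegree ℓ ≤ degAt (H (suc m)) (9 * m + ℓ)
capDegree≤ m = window-degree m 0 (+-identityʳ m) 19 17 (upTo 18) rungedCap id id s≤s⁻¹ refl refl
  (All.map (λ ℓ< → ℓ< , refl) (from-yes (All.all? (λ ℓ → suc ℓ <? 19) (upTo 18)))) cap

earDegree≤ : ∀ m {ℓ} → ℓ < 2 → earDegree ℓ ≤ degAt (H (suc m)) (18 + 18 * m + ℓ)
earDegree≤ m {ℓ} ℓ<2 = ≤-trans (H-embedding m 4 earPattern ε ε< ε-injective
    ((inj₁ closing) ∷ (inj₁ ear) ∷ inj₁ (path (n≤1+n _)) ∷ inj₁ (path ≤-refl) ∷ []) {2 + ℓ} (s≤s (s≤s ℓ<2)))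
  (≤-reflexive (cong (degAt (H (suc m))) (lemma m ℓ)))
  where
  ε : ℕ → ℕ
  ε = extend 0 (λ ℓ → ℓ + (17 + 18 * m))
  ε< : ∀ {p} → p < 4 → ε p < 20 + 18 * m
  ε< {zero}  _   = s≤s z≤n
  ε< {suc p} p<4 = +-monoˡ-≤ (17 + 18 * m) (s≤s⁻¹ p<4)
  ε-injective : ∀ {p q} → p < 4 → q < 4 → ε p ≡ ε q → p ≡ q
  ε-injective {zero}  {zero}  _ _ _  = refl
  ε-injective {zero}  {suc q} _ _ eq with () ← trans eq (+-comm q (17 + 18 * m))
  ε-injective {suc p} {zero}  _ _ eq with () ← trans (sym eq) (+-comm p (17 + 18 * m))
  ε-injective {suc p} {suc q} _ _ eq = cong suc (+-cancelʳ-≡ (17 + 18 * m) p q eq)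
  lemma : ∀ m ℓ → suc ℓ + (17 + 18 * m) ≡ 18 + 18 * m + ℓ
  lemma = solve-∀

-- From lower bounds to exact degrees

applyUpTo-+ : ∀ (f : ℕ → ℕ) m n → applyUpTo f (m + n) ≡ applyUpTo f m ++ applyUpTo (λ x → f (m + x)) n
applyUpTo-+ f zero    n = refl
applyUpTo-+ f (suc m) n = cong (f 0 ∷_) (applyUpTo-+ (f ∘ suc) m n)

applyUpTo-pointwise : ∀ {f g : ℕ → ℕ} n → (∀ {x} → x < n → f x ≤ g x) → Pointwise _≤_ (applyUpTo f n) (applyUpTo g n)
applyUpTo-pointwise zero    _   = []
applyUpTo-pointwise (suc n) f≤g = f≤g (s≤s z≤n) ∷ applyUpTo-pointwise n (f≤g ∘ s≤s)

periodic-pointwise : ∀ (f g : ℕ → ℕ) m n → (∀ {j x} → j < m → x < n → f x ≤ g (j * n + x)) →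
  Pointwise _≤_ (concat (replicate m (applyUpTo f n))) (applyUpTo g (m * n))
periodic-pointwise f g zero    n _   = []
periodic-pointwise f g (suc m) n f≤g rewrite applyUpTo-+ g n (m * n) =
  Pointwise.++⁺ (applyUpTo-pointwise n (f≤g (s≤s z≤n)))
    (periodic-pointwise f (λ x → g (n + x)) m n
      (λ {j} {x} j<m x<n → ≤-trans (f≤g (s≤s j<m) x<n) (≤-reflexive (cong g (+-assoc n (j * n) x)))))

-- A strict inequality at any entry would make `sum ys` exceed `sum xs`.
pointwise-tight : ∀ {xs ys} → Pointwise _≤_ xs ys → sum ys ≤ sum xs → xs ≡ ys
pointwise-tight [] _ = refl
pointwise-tight {x ∷ xs} {y ∷ ys} (x≤y ∷ xs≤ys) ∑≥ =
  cong₂ _∷_ x≡y (pointwise-tight xs≤ys (+-cancelˡ-≤ x (sum ys) (sum xs) (subst (λ z → z + sum ys ≤ x + sum xs) (sym x≡y) ∑≥)))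
  where
  sum-mono : ∀ {xs ys} → Pointwise _≤_ xs ys → sum xs ≤ sum ys
  sum-mono []              = z≤n
  sum-mono (x≤y ∷ xs≤ys) = +-mono-≤ x≤y (sum-mono xs≤ys)
  x≡y : x ≡ y
  x≡y = ≤-antisym x≤y (+-cancelʳ-≤ (sum ys) y x (≤-trans ∑≥ (+-monoʳ-≤ x (sum-mono xs≤ys))))

sum-concat-replicate : ∀ m xs → sum (concat (replicate m xs)) ≡ m * sum xs
sum-concat-replicate zero    xs = refl
sum-concat-replicate (suc m) xs = trans (sum-++ xs (concat (replicate m xs))) (cong (sum xs +_) (sum-concat-replicate m xs))

-- `sideDegrees` serves labels 0 to 8 of a block and also labels 11 to 19. Labels 9 and 10 are the
-- rung ends of the next level and are counted there.
sideDegrees capDegrees : List ℕ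
sideDegrees = 8 ∷ 2 ∷ 5 ∷ 2 ∷ 5 ∷ 2 ∷ 5 ∷ 2 ∷ 5 ∷ []
capDegrees = 5 ∷ 5 ∷ 2 ∷ 6 ∷ 2 ∷ 5 ∷ 2 ∷ 5 ∷ 2 ∷ 3 ∷ 6 ∷ 2 ∷ 5 ∷ 5 ∷ 2 ∷ 5 ∷ 2 ∷ 5 ∷ []

degreeList : ℕ → List ℕ
degreeList m = concat (replicate m sideDegrees) ++ capDegrees ++ concat (replicate m sideDegrees) ++ 2 ∷ 3 ∷ []

-- The vertices fall into four arcs: left sides of the blocks, cap, right sides, last two vertices.
-- The numerals in the degree lists are checked here, by evaluating the degrees in the windows.
degreeList≤ : ∀ m → Pointwise _≤_ (degreeList m) (degrees (H (suc m)))
degreeList≤ m = subst (Pointwise _≤_ (degreeList m)) (sym split)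
  (Pointwise.++⁺ (periodic-pointwise stripDegree D m 9 left)
  (Pointwise.++⁺ (applyUpTo-pointwise {capDegree} 18 middle)
  (Pointwise.++⁺ (periodic-pointwise (λ ℓ → stripDegree (11 + ℓ)) (λ x → D (m * 9 + (18 + x))) m 9 right)
    (applyUpTo-pointwise {earDegree} 2 last))))
  where
  D : ℕ → ℕ
  D = degAt (H (suc m))
  n≡ : ∀ m → 18 * suc m + 2 ≡ m * 9 + (18 + (m * 9 + 2))
  n≡ = solve-∀
  split : degrees (H (suc m)) ≡ applyUpTo D (m * 9) ++ applyUpTo (λ x → D (m * 9 + x)) 18 ++
    applyUpTo (λ x → D (m * 9 + (18 + x))) (m * 9) ++ applyUpTo (λ x → D (m * 9 + (18 + (m * 9 + x)))) 2
  split = begin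
    degrees (H (suc m))                       ≡⟨ degrees-applyUpTo (H (suc m)) ⟩
    applyUpTo D (order (suc m))               ≡⟨ cong (applyUpTo D) (n≡ m) ⟩
    applyUpTo D (m * 9 + (18 + (m * 9 + 2)))  ≡⟨ applyUpTo-+ D (m * 9) _ ⟩
    applyUpTo D (m * 9) ++ applyUpTo (λ x → D (m * 9 + x)) (18 + (m * 9 + 2))
      ≡⟨ cong (applyUpTo D (m * 9) ++_) (applyUpTo-+ (λ x → D (m * 9 + x)) 18 _) ⟩
    applyUpTo D (m * 9) ++ applyUpTo (λ x → D (m * 9 + x)) 18 ++ applyUpTo (λ x → D (m * 9 + (18 + x))) (m * 9 + 2)
      ≡⟨ cong (λ t → applyUpTo D (m * 9) ++ applyUpTo (λ x → D (m * 9 + x)) 18 ++ t)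
           (applyUpTo-+ (λ x → D (m * 9 + (18 + x))) (m * 9) 2) ⟩
    _ ∎
    where open ≡-Reasoning
  left : ∀ {j ℓ} → j < m → ℓ < 9 → stripDegree ℓ ≤ D (j * 9 + ℓ)
  left {j} {ℓ} j<m ℓ<9 with r , eq ← m≤n⇒∃[o]m+o≡n j<m =
    subst (λ x → stripDegree ℓ ≤ D x) (cong₂ _+_ (*-comm 9 j) (ψ-low r ℓ<9)) (stripDegree≤ j r eq (≤-trans ℓ<9 (m≤m+n 9 12)))
    where
    ψ-low : ∀ r {ℓ} → ℓ < 9 → ψ r ℓ ≡ ℓ
    ψ-low r {ℓ} ℓ<9 with ℓ <ᵇ 10 in ℓ?
    ... | true  = refl
    ... | false = contradiction (subst T ℓ? (<⇒<ᵇ (m≤n⇒m≤1+n ℓ<9))) id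
  middle : ∀ {ℓ} → ℓ < 18 → capDegree ℓ ≤ D (m * 9 + ℓ)
  middle {ℓ} ℓ<18 = subst (λ x → capDegree ℓ ≤ D (x + ℓ)) (*-comm 9 m) (capDegree≤ m (m≤n⇒m≤1+n ℓ<18))
  -- The right sides appear from the innermost block outwards, so `j` counts the blocks inside the
  -- current one and the complement `i` is its index.
  right : ∀ {j ℓ} → j < m → ℓ < 9 → stripDegree (11 + ℓ) ≤ D (m * 9 + (18 + (j * 9 + ℓ)))
  right {j} {ℓ} j<m ℓ<9 with i , eq ← m≤n⇒∃[o]m+o≡n j<m =
    subst (λ x → stripDegree (11 + ℓ) ≤ D x)
      (trans (lemma i j ℓ) (cong (λ m → m * 9 + (18 + (j * 9 + ℓ))) eq))
      (stripDegree≤ i j (trans (cong suc (+-comm i j)) eq) (≤-trans (+-monoʳ-≤ 11 ℓ<9) (n≤1+n 20)))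
    where
    lemma : ∀ i j ℓ → 9 * i + (16 + 18 * j + (11 + ℓ)) ≡ (suc j + i) * 9 + (18 + (j * 9 + ℓ))
    lemma = solve-∀
  last : ∀ {ℓ} → ℓ < 2 → earDegree ℓ ≤ D (m * 9 + (18 + (m * 9 + ℓ)))
  last {ℓ} ℓ<2 = subst (λ x → earDegree ℓ ≤ D x) (lemma m ℓ) (earDegree≤ m ℓ<2)
    where
    lemma : ∀ m ℓ → 18 + 18 * m + ℓ ≡ m * 9 + (18 + (m * 9 + ℓ))
    lemma = solve-∀

sum-degreeList : ∀ m → sum (degreeList m) + 6 ≡ 4 * order (suc m)
sum-degreeList m = begin
  sum (side ++ capDegrees ++ side ++ 2 ∷ 3 ∷ []) + 6
    -- 69 is the sum of `capDegrees` and 5 that of the last two vertices.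
    ≡⟨ cong (_+ 6) (trans (sum-++ side _) (cong (λ t → sum side + (69 + t)) (sum-++ side _))) ⟩
  sum side + (69 + (sum side + 5)) + 6
    ≡⟨ cong (λ t → t + (69 + (t + 5)) + 6) (sum-concat-replicate m sideDegrees) ⟩
  m * 36 + (69 + (m * 36 + 5)) + 6
    ≡⟨ lemma m ⟩
  4 * (18 * suc m + 2)
    ∎
  where
  open ≡-Reasoning
  side : List ℕ
  side = concat (replicate m sideDegrees)
  lemma : ∀ m → m * 36 + (69 + (m * 36 + 5)) + 6 ≡ 4 * (18 * suc m + 2)
  lemma = solve-∀

2≤order : ∀ k → 2 ≤ order k
2≤order k = m≤n+m 2 (18 * k)

-- The lower bounds already sum to 4n - 6, the maximum for an outerplanar graph.
degrees-H : ∀ m → degreeList m ≡ degrees (H (suc m))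
degrees-H m = pointwise-tight (degreeList≤ m) (+-cancelʳ-≤ 6 _ _ (begin
  sum (degrees (H (suc m))) + 6  ≡⟨ cong (_+ 6) (sum-degrees (H (suc m))) ⟩
  ∑ (deg (H (suc m))) + 6        ≤⟨ outerplanar⇒degreeSum {G = H (suc m)} (2≤order (suc m)) (H-outerplanar m) ⟩
  4 * order (suc m)              ≡⟨ sum-degreeList m ⟨
  sum (degreeList m) + 6         ∎))
  where open ≤-Reasoning

H-maximalOuterplanar : ∀ m → MaximalOuterplanar (H (suc m))
H-maximalOuterplanar m = maximalOuterplanar {G = H (suc m)} (2≤order (suc m)) (H-outerplanar m) (≤-reflexive (begin
  4 * order (suc m)              ≡⟨ sum-degreeList m ⟨
  sum (degreeList m) + 6         ≡⟨ cong (λ ds → sum ds + 6) (degrees-H m) ⟩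
  sum (degrees (H (suc m))) + 6  ≡⟨ cong (_+ 6) (sum-degrees (H (suc m))) ⟩
  ∑ (deg (H (suc m))) + 6        ∎))
  where open ≡-Reasoning

-- Multiplicities and spread

expand : List (ℕ × ℕ) → List ℕ
expand = concatMap (λ (d , n) → replicate n d)

insert : ℕ → List (ℕ × ℕ) → List (ℕ × ℕ)
insert d []             = (d , 1) ∷ []
insert d ((e , n) ∷ ps) with d ≟ e
... | yes _ = (e , suc n) ∷ ps
... | no  _ = (e , n) ∷ insert d ps

insert-↭ : ∀ d ps → d ∷ expand ps ↭ expand (insert d ps)
insert-↭ d []             = ↭-refl
insert-↭ d ((e , n) ∷ ps) with d ≟ e
... | yes refl = ↭-refl
... | no  _    = ↭-trans (↭-sym (shift d (replicate n e) (expand ps))) (++⁺ˡ (replicate n e) (insert-↭ d ps))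

-- For numerals `ds` the fold evaluates even when multiplicities contain variables, so it yields
-- permutations by computation.
insertAll-↭ : ∀ ds ps → ds ++ expand ps ↭ expand (foldr insert ps ds)
insertAll-↭ []       ps = ↭-refl
insertAll-↭ (d ∷ ds) ps = ↭-trans (prep d (insertAll-↭ ds ps)) (insert-↭ d (foldr insert ps ds))

-- All five degrees are present, if need be with multiplicity 0, so that `insert` never appends one
-- of them and the order stays fixed.
tally : ℕ → ℕ → ℕ → ℕ → ℕ → List (ℕ × ℕ)
tally n₂ n₃ n₅ n₆ n₈ = (2 , n₂) ∷ (3 , n₃) ∷ (5 , n₅) ∷ (6 , n₆) ∷ (8 , n₈) ∷ []

sideDegrees-↭ : ∀ m n₂ n₃ n₅ n₆ n₈ → concat (replicate m sideDegrees) ++ expand (tally n₂ n₃ n₅ n₆ n₈) ↭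
  expand (tally (m * 4 + n₂) n₃ (m * 4 + n₅) n₆ (m + n₈))
sideDegrees-↭ zero    _  _  _  _  _  = ↭-refl
sideDegrees-↭ (suc m) n₂ n₃ n₅ n₆ n₈ =
  ↭-trans (↭-reflexive (++-assoc sideDegrees (concat (replicate m sideDegrees)) _))
    (↭-trans (++⁺ˡ sideDegrees (sideDegrees-↭ m n₂ n₃ n₅ n₆ n₈))
      (insertAll-↭ sideDegrees (tally (m * 4 + n₂) n₃ (m * 4 + n₅) n₆ (m + n₈))))

degreeTally : ℕ → List (ℕ × ℕ)
degreeTally m = tally (8 * suc m) 2 (8 * suc m) 2 (2 * suc m ∸ 2)

degreeList-↭ : ∀ m → degreeList m ↭ expand (degreeTally m)
-- The last two vertices form `tally 1 1 0 0 0`; the other arcs are added from right to left.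
degreeList-↭ m = ↭-trans (++⁺ˡ side (++⁺ˡ capDegrees (sideDegrees-↭ m 1 1 0 0 0)))
  (↭-trans (++⁺ˡ side (insertAll-↭ capDegrees (tally (m * 4 + 1) 1 (m * 4 + 0) 0 (m + 0))))
  (↭-trans (sideDegrees-↭ m (7 + (m * 4 + 1)) 2 (8 + (m * 4 + 0)) 2 (m + 0))
  (↭-reflexive (cong₂ (λ (n₂ , n₅) n₈ → expand (tally n₂ 2 n₅ 2 n₈)) (cong₂ _,_ (n₂≡ m) (n₅≡ m)) (sym n₈≡)))))
  where
  side : List ℕ
  side = concat (replicate m sideDegrees)
  n₂≡ : ∀ m → m * 4 + (7 + (m * 4 + 1)) ≡ 8 * suc m
  n₂≡ = solve-∀
  n₅≡ : ∀ m → m * 4 + (8 + (m * 4 + 0)) ≡ 8 * suc m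
  n₅≡ = solve-∀
  n₈≡ : 2 * suc m ∸ 2 ≡ m + (m + 0)
  n₈≡ = trans (cong (_∸ 2) (*-suc 2 m)) refl

degrees-↭ : ∀ m → degrees (H (suc m)) ↭ expand (degreeTally m)
degrees-↭ m = subst (_↭ expand (degreeTally m)) (degrees-H m) (degreeList-↭ m)

∣tabulate∣-filter : ∀ {n p} {P : ℕ → Set p} (P? : U.Decidable P) (f : Fin n → ℕ) →
  ∣ Vec.tabulate (λ u → does (P? (f u))) ∣ ≡ length (filter P? (tabulate f))
∣tabulate∣-filter {zero}  P? f = refl
∣tabulate∣-filter {suc n} P? f with does (P? (f zero))
... | true  = cong suc (∣tabulate∣-filter P? (f ∘ suc))
... | false = ∣tabulate∣-filter P? (f ∘ suc)

length-filter-replicate : ∀ {p} {P : ℕ → Set p} (P? : U.Decidable P) n d →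
  length (filter P? (replicate n d)) ≡ (if does (P? d) then n else 0)
length-filter-replicate P? zero    d with does (P? d)
... | true  = refl
... | false = refl
length-filter-replicate P? (suc n) d with does (P? d) | length-filter-replicate P? n d
... | true  | eq = cong suc eq
... | false | eq = eq

length-filter-expand : ∀ {p} {P : ℕ → Set p} (P? : U.Decidable P) ps →
  length (filter P? (expand ps)) ≡ sum (map (λ (d , n) → if does (P? d) then n else 0) ps)
length-filter-expand P? []             = refl
length-filter-expand P? ((d , n) ∷ ps) = begin
  length (filter P? (replicate n d ++ expand ps))
    ≡⟨ cong length (filter-++ P? (replicate n d) (expand ps)) ⟩
  length (filter P? (replicate n d) ++ filter P? (expand ps))
    ≡⟨ length-++ (filter P? (replicate n d)) ⟩
  length (filter P? (replicate n d)) + length (filter P? (expand ps))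
    ≡⟨ cong₂ _+_ (length-filter-replicate P? n d) (length-filter-expand P? ps) ⟩
  _
    ∎
  where open ≡-Reasoning

-- Sets of spread at most 2

InRange : ℕ → ℕ → Set
InRange lo d = lo ≤ d × d ≤ 2 + lo

inRange? : ∀ lo → U.Decidable (InRange lo)
inRange? lo d = (lo ≤? d) ×-dec (d ≤? 2 + lo)

degreesIn : ∀ {n} → Graph n → ℕ → Subset n
degreesIn G lo = Vec.tabulate (λ u → does (inRange? lo (deg G u)))

∈-degreesIn⁺ : ∀ {n} (G : Graph n) {lo u} → InRange lo (deg G u) → u Subset.∈ degreesIn G lo
∈-degreesIn⁺ G {lo} {u} r = Vec.lookup⇒[]= u _ (trans (Vec.lookup∘tabulate _ u) (dec-true (inRange? lo (deg G u)) r))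

∈-degreesIn⁻ : ∀ {n} (G : Graph n) {lo u} → u Subset.∈ degreesIn G lo → InRange lo (deg G u)
∈-degreesIn⁻ G {lo} {u} u∈ = witness (inRange? lo (deg G u))
  (trans (sym (Vec.lookup∘tabulate (λ u → does (inRange? lo (deg G u))) u)) (Vec.[]=⇒lookup u∈))
  where
  witness : ∀ {P : Set} (P? : Dec P) → does P? ≡ true → P
  witness (yes p) _ = p

subsets-complete : ∀ {n} (B : Subset n) → B ∈ subsets n
subsets-complete Vec.[]                  = here refl
subsets-complete (false Vec.∷ B)         = ∈-++⁺ˡ (∈-map⁺ (outside Vec.∷_) (subsets-complete B))
subsets-complete {suc n} (true Vec.∷ B)  = ∈-++⁺ʳ (map (outside Vec.∷_) (subsets n)) (∈-map⁺ (inside Vec.∷_) (subsets-complete B))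

degreesOf : ∀ {n} → Graph n → Subset n → List ℕ
degreesOf {n} G B = map (deg G) (filter (Subset._∈? B) (allFin n))

-- `lo` is the least degree in `B`. For empty `B` it is the default 0, and the inclusion is vacuous.
spread≤2⇒⊆degreesIn : ∀ {n} (G : Graph n) B → spread G B ≤ 2 → ∃[ lo ] B Subset.⊆ degreesIn G lo
spread≤2⇒⊆degreesIn G B sp≤2 = lo , λ {u} u∈B →
  let d∈ = ∈-map⁺ (deg G) (∈-filter⁺ (Subset._∈? B) (∈-allFin u) u∈B) in
  ∈-degreesIn⁺ G (All.lookup (min≤xs hi ds) d∈ ,
    ≤-trans (All.lookup (xs≤max 0 ds) d∈) (≤-trans (m≤n+m∸n hi lo) (≤-trans (+-monoʳ-≤ lo sp≤2) (≤-reflexive (+-comm lo 2)))))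
  where
  ds : List ℕ
  ds = degreesOf G B
  hi lo : ℕ
  hi = max 0 ds
  lo = min hi ds

-- Either the minimum equals its default, the maximum, and the spread is 0, which covers the empty
-- set; or it is attained, and both extremes lie in the range.
spread-degreesIn : ∀ {n} (G : Graph n) lo → spread G (degreesIn G lo) ≤ 2
spread-degreesIn {n} G lo with argmin-sel id (max 0 (degreesOf G (degreesIn G lo))) (degreesOf G (degreesIn G lo))
... | inj₁ min≡max = ≤-trans (≤-reflexive (trans (cong (hi ∸_) min≡max) (n∸n≡0 hi))) z≤n
  where
  hi : ℕ
  hi = max 0 (degreesOf G (degreesIn G lo))
... | inj₂ min∈ = ≤-trans (∸-mono (max≤v⁺ z≤n (All.map proj₂ inRange)) (proj₁ (All.lookup inRange min∈)))
        (≤-reflexive (m+n∸n≡m 2 lo))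
  where
  inRange : All (InRange lo) (degreesOf G (degreesIn G lo))
  inRange = All.map⁺ (All.map (∈-degreesIn⁻ G) (All.all-filter (Subset._∈? degreesIn G lo) (allFin n)))

sp-2 : ∀ {n} (G : Graph n) {s} lo → ∣ degreesIn G lo ∣ ≡ s → (∀ lo′ → ∣ degreesIn G lo′ ∣ ≤ s) → sp G 2 ≡ s
sp-2 {n} G {s} lo attained bound = ≤-antisym
  (max≤v⁺ z≤n (All.map⁺ (All.map size≤ (All.all-filter (λ B → spread G B ≤? 2) (subsets n)))))
  (v≤max⁺ 0 (map ∣_∣ (filter (λ B → spread G B ≤? 2) (subsets n))) (inj₂ (lose
    (∈-map⁺ ∣_∣ (∈-filter⁺ (λ B → spread G B ≤? 2) (subsets-complete (degreesIn G lo)) (spread-degreesIn G lo)))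
    (≤-reflexive (sym attained)))))
  where
  size≤ : ∀ {B} → spread G B ≤ 2 → ∣ B ∣ ≤ s
  size≤ {B} sp≤2 = let lo′ , B⊆ = spread≤2⇒⊆degreesIn G B sp≤2 in
    ≤-trans (Subset.p⊆q⇒∣p∣≤∣q∣ B⊆) (bound lo′)

inRangeCount : ℕ → List (ℕ × ℕ) → ℕ
inRangeCount lo ps = sum (map (λ (d , n) → if does (inRange? lo d) then n else 0) ps)

-- The size depends only on the multiset of degrees.
∣degreesIn∣ : ∀ m lo → ∣ degreesIn (H (suc m)) lo ∣ ≡ inRangeCount lo (degreeTally m)
∣degreesIn∣ m lo = begin
  ∣ degreesIn (H (suc m)) lo ∣
    ≡⟨ ∣tabulate∣-filter (inRange? lo) (deg (H (suc m))) ⟩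
  length (filter (inRange? lo) (tabulate (deg (H (suc m)))))
    ≡⟨ cong (length ∘ filter (inRange? lo)) (map-tabulate id (deg (H (suc m)))) ⟨
  length (filter (inRange? lo) (degrees (H (suc m))))
    ≡⟨ ↭-length (filter-↭ (inRange? lo) (degrees-↭ m)) ⟩
  length (filter (inRange? lo) (expand (degreeTally m)))
    ≡⟨ length-filter-expand (inRange? lo) (degreeTally m) ⟩
  inRangeCount lo (degreeTally m)
    ∎
  where open ≡-Reasoning

-- A range of three consecutive values cannot contain both 2 and 5. With one of them it adds at most
-- the two vertices of degree 3 or of degree 6; a range containing 8 has neither.
inRangeCount≤ : ∀ n e → e ≤ n → ∀ lo → inRangeCount lo (tally n 2 n 2 e) ≤ n + 2
inRangeCount≤ n e e≤n 0 = +-monoʳ-≤ n z≤n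
inRangeCount≤ n e e≤n 1 = ≤-refl
inRangeCount≤ n e e≤n 2 = ≤-refl
inRangeCount≤ n e e≤n 3 = ≤-reflexive (trans (cong (2 +_) (+-identityʳ n)) (+-comm 2 n))
inRangeCount≤ n e e≤n 4 = ≤-refl
inRangeCount≤ n e e≤n 5 = ≤-refl
inRangeCount≤ n e e≤n 6 = ≤-trans (+-monoʳ-≤ 2 (≤-trans (≤-reflexive (+-identityʳ e)) e≤n)) (≤-reflexive (+-comm 2 n))
inRangeCount≤ n e e≤n 7 = +-mono-≤ e≤n z≤n
inRangeCount≤ n e e≤n 8 = +-mono-≤ e≤n z≤n
inRangeCount≤ n e e≤n (suc (suc (suc (suc (suc (suc (suc (suc (suc _))))))))) = z≤n

sp-H : ∀ m → sp (H (suc m)) 2 ≡ 8 * suc m + 2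
-- The range from 2 to 4 takes in all vertices of degree 2 and 3.
sp-H m = sp-2 (H (suc m)) 2 (∣degreesIn∣ m 2) λ lo →
  ≤-trans (≤-reflexive (∣degreesIn∣ m lo)) (inRangeCount≤ (8 * suc m) (2 * suc m ∸ 2)
    (≤-trans (m∸n≤m (2 * suc m) 2) (*-monoˡ-≤ (suc m) (m≤m+n 2 6))) lo)

-- Opened only here, because +_ makes sections such as (x +_) of addition on ℕ ambiguous.
open import Data.Integer as ℤ using (+_)
import Data.Integer.Properties as ℤ

ratio : ∀ k → (+ (8 * k + 2)) / 1 ≡ (+ (4 * order k + 10)) / 9
-- `mkℚᵘ` stores the denominator minus one, so 0 and 8 encode 1 and 9.
ratio k = ℚ.fromℚᵘ-cong {mkℚᵘ (+ (8 * k + 2)) 0} {mkℚᵘ (+ (4 * order k + 10)) 8} (*≡* (begin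
  + (8 * k + 2) ℤ.* + 9       ≡⟨ ℤ.pos-* (8 * k + 2) 9 ⟨
  + ((8 * k + 2) * 9)         ≡⟨ cong +_ (lemma k) ⟩
  + ((4 * order k + 10) * 1)  ≡⟨ ℤ.pos-* (4 * order k + 10) 1 ⟩
  + (4 * order k + 10) ℤ.* + 1     ∎))
  where
  open ≡-Reasoning
  lemma : ∀ k → (8 * k + 2) * 9 ≡ (4 * (18 * k + 2) + 10) * 1
  lemma = solve-∀

theorem20 : ∀ (k : ℕ) → k ≥ 1 →
    MaximalOuterplanar (H k)
    × degrees (H k) ↭ (replicate (8 * k) 2 ++ replicate 2 3 ++ replicate (8 * k) 5
    ++ replicate 2 6 ++ replicate (2 * k ∸ 2) 8)
    × sp (H k) 2 ≡ 8 * k + 2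
    × (+ (8 * k + 2)) / 1 ≡ (+ (4 * order k + 10)) / 9
theorem20 k@(suc m) _ = H-maximalOuterplanar m , subst (degrees (H k) ↭_) last≡ (degrees-↭ m) , sp-H m , ratio k
  where
  last≡ : expand (degreeTally m) ≡ replicate (8 * k) 2 ++ replicate 2 3 ++ replicate (8 * k) 5
    ++ replicate 2 6 ++ replicate (2 * k ∸ 2) 8
  last≡ = cong (λ t → replicate (8 * k) 2 ++ replicate 2 3 ++ replicate (8 * k) 5 ++ replicate 2 6 ++ t) (++-identityʳ _)
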